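{- Let $k$ be a positive integer and let $r \ge 0$, $s \in (0,1)$ and $p \in (0,1/2]$ be real numbers. Then the random $k$-CNF-XOR formula $\psi^{p}_{k}(n, rn, sn)$ is with high probability $\Omega(n)$-separated; that is, there exists a function $g(n) \in \Omega(n)$ such that $\lim_{n\to\infty} \Pr[\psi^{p}_{k}(n, rn, sn) \text{ is } g(n)\text{ -separated}] = 1$.
   Context: Let $X_1, \dots, X_n$ be propositional variables. A $k$-clause is a disjunction of $k$ literals on $k$ distinct variables among $X_1,\dots,X_n$, each variable possibly negated (so there are $\binom{n}{k}2^k$ of them; $n \ge k$ is assumed). An XOR-clause over $n$ variables is the exclusive-or of exactly one of the constants $0$ or $1$ together with a subset of the variables $X_1,\dots,X_n$; if it includes the constant $0$ (respectively $1$), it evaluates to true under a truth assignment if and only if an odd (respectively even) number of its included variables evaluate to true. A random XOR-clause with variable-probability $p \in [0,1]$ is obtained by including each $X_i$ independently with probability $p$, and (independently) including the constant $1$ with probability $1/2$ and the constant $0$ otherwise. $\psi^{p}_{k}(n, rn, sn)$ denotes the random formula that is the conjunction of $\lceil rn\rceil$ $k$-clauses, each chosen uniformly and independently from all $k$-clauses over $n$ variables, and $\lceil sn\rceil$ independently chosen random XOR-clauses over $n$ variables with variable-probability $p$. A solution of a formula is a truth assignment to $X_1,\dots,X_n$ under which the formula evaluates to true. For a real number $d$, a formula is $d$-separated if the Hamming distance between every pair of distinct solutions is at least $d$ (vacuously true if there are fewer than two solutions). $g(n)\in\Omega(n)$ means there is a constant $c>0$ with $g(n)\ge cn$ for all sufficiently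 large $n$. A sequence of events $E_n$ occurs with high probability if $\Pr[E_n]\to 1$ as $n\to\infty$. -}

module Defs where

open import Data.Bool using (Bool; true; false; _∧_; _xor_; if_then_else_)
open import Data.Fin.Subset using (Subset; ∣_∣)
open import Data.Integer using (+_)
open import Data.List using (List; []; _∷_; [_]; map; concatMap; filter; foldr; length; cartesianProductWith)
open import Data.Maybe using (Maybe; nothing; just; is-just)
open import Data.Nat using (ℕ; zero; suc)
import Data.Nat as ℕ
import Data.Nat.Properties as ℕ
open import Data.Product using (∃; ∃-syntax; _×_; _,_; map₂)
open import Data.Rational using (ℚ; 0ℚ; 1ℚ; ½; _/_; 1/_; Positive)
import Data.Rational as ℚ
import Data.Rational.Properties as ℚ
open import Data.Rational.Solver using (module +-*-Solver)
open import Data.Vec using (Vec; []; _∷_; lookup; zipWith)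
import Data.Vec as Vec
open import Data.Vec.Relation.Unary.All using (All)
open import Level using (0ℓ)
open import Relation.Binary.PropositionalEquality using (_≡_; _≢_; refl; sym; trans; cong; cong₂; subst)
open import Relation.Nullary.Decidable using (does)
open import Relation.Unary using (Pred; Decidable)

------------------------------------------------------------------------
-- Real numbers: Cauchy sequences of rationals, in the textbook sense.
-- Two sequences with difference tending to 0 denote the same real; all
-- the notions below respect this identification.

IsCauchy : (ℕ → ℚ) → Set
IsCauchy x = ∀ ε → 0ℚ ℚ.< ε →
  ∃[ N ] (∀ m n → N ℕ.≤ m → N ℕ.≤ n → ℚ.∣ x m ℚ.- x n ∣ ℚ.≤ ε)

record ℝ : Set where
  constructor mkℝ
  field
    seq    : ℕ → ℚ
    cauchy : IsCauchy seq

open ℝ public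

infix 4 _<_ _≤_

_<_ : ℝ → ℝ → Set
x < y = ∃[ ε ] 0ℚ ℚ.< ε × ∃[ N ] (∀ n → N ℕ.≤ n → seq x n ℚ.+ ε ℚ.≤ seq y n)

_≤_ : ℝ → ℝ → Set
x ≤ y = ∀ ε → 0ℚ ℚ.< ε → ∃[ N ] (∀ n → N ℕ.≤ n → seq x n ℚ.≤ seq y n ℚ.+ ε)

private
  abstract
    0<½ε : ∀ {ε} → 0ℚ ℚ.< ε → 0ℚ ℚ.< ½ ℚ.* ε
    0<½ε 0<ε = ℚ.*-monoʳ-<-pos ½ 0<ε

    ½ε+½ε : ∀ ε → ½ ℚ.* ε ℚ.+ ½ ℚ.* ε ≡ ε
    ½ε+½ε ε = trans (sym (ℚ.*-distribʳ-+ ε ½ ½)) (ℚ.*-identityˡ ε)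

    cauchy-const : ∀ q → IsCauchy (λ _ → q)
    cauchy-const q ε 0<ε = 0 , λ _ _ _ _ →
      subst (λ d → ℚ.∣ d ∣ ℚ.≤ ε) (sym (ℚ.+-inverseʳ q)) (ℚ.<⇒≤ 0<ε)

    cauchy-+ : ∀ {x y} → IsCauchy x → IsCauchy y → IsCauchy (λ n → x n ℚ.+ y n)
    cauchy-+ {x} {y} cx cy ε 0<ε
      with cx (½ ℚ.* ε) (0<½ε 0<ε) | cy (½ ℚ.* ε) (0<½ε 0<ε)
    ... | M , hx | N , hy = M ℕ.⊔ N , λ m n m≥ n≥ → begin
        ℚ.∣ (x m ℚ.+ y m) ℚ.- (x n ℚ.+ y n) ∣
          ≡⟨ cong ℚ.∣_∣ (rearrange (x m) (y m) (x n) (y n)) ⟩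
        ℚ.∣ (x m ℚ.- x n) ℚ.+ (y m ℚ.- y n) ∣
          ≤⟨ ℚ.∣p+q∣≤∣p∣+∣q∣ (x m ℚ.- x n) (y m ℚ.- y n) ⟩
        ℚ.∣ x m ℚ.- x n ∣ ℚ.+ ℚ.∣ y m ℚ.- y n ∣
          ≤⟨ ℚ.+-mono-≤ (hx m n (ℕ.m⊔n≤o⇒m≤o M N m≥) (ℕ.m⊔n≤o⇒m≤o M N n≥))
                        (hy m n (ℕ.m⊔n≤o⇒n≤o M N m≥) (ℕ.m⊔n≤o⇒n≤o M N n≥)) ⟩
        ½ ℚ.* ε ℚ.+ ½ ℚ.* ε
          ≡⟨ ½ε+½ε ε ⟩
        ε ∎
      where
      open ℚ.≤-Reasoning
      rearrange : ∀ a b c d → (a ℚ.+ b) ℚ.- (c ℚ.+ d) ≡ (a ℚ.- c) ℚ.+ (b ℚ.- d)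
      rearrange = +-*-Solver.solve 4 (λ a b c d →
        ((a :+ b) :- (c :+ d)) := ((a :- c) :+ (b :- d))) refl
        where open +-*-Solver

    cauchy-neg : ∀ {x} → IsCauchy x → IsCauchy (λ n → ℚ.- x n)
    cauchy-neg {x} cx ε 0<ε with cx ε 0<ε
    ... | N , h = N , λ m n m≥ n≥ →
        subst (ℚ._≤ ε)
          (trans (sym (ℚ.∣-p∣≡∣p∣ (x m ℚ.- x n))) (cong ℚ.∣_∣ (ℚ.neg-distrib-+ (x m) (ℚ.- x n))))
          (h m n m≥ n≥)

    bounded : ∀ {x} → IsCauchy x →
      ∃[ B ] Positive B × ∃[ N ] (∀ n → N ℕ.≤ n → ℚ.∣ x n ∣ ℚ.≤ B)
    bounded {x} cx with cx 1ℚ (ℚ.positive⁻¹ 1ℚ)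
    ... | N , h =
        1ℚ ℚ.+ ℚ.∣ x N ∣
      , ℚ.pos+nonNeg⇒pos 1ℚ ℚ.∣ x N ∣ {{ℚ.∣-∣-nonNeg (x N)}}
      , N
      , λ n n≥ → begin
          ℚ.∣ x n ∣                          ≡⟨ cong ℚ.∣_∣ (rearrange (x n) (x N)) ⟩
          ℚ.∣ (x n ℚ.- x N) ℚ.+ x N ∣        ≤⟨ ℚ.∣p+q∣≤∣p∣+∣q∣ (x n ℚ.- x N) (x N) ⟩
          ℚ.∣ x n ℚ.- x N ∣ ℚ.+ ℚ.∣ x N ∣    ≤⟨ ℚ.+-monoˡ-≤ ℚ.∣ x N ∣ (h n N n≥ ℕ.≤-refl) ⟩
          1ℚ ℚ.+ ℚ.∣ x N ∣                   ∎
      where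
      open ℚ.≤-Reasoning
      rearrange : ∀ a b → a ≡ (a ℚ.- b) ℚ.+ b
      rearrange = +-*-Solver.solve 2 (λ a b → a := ((a :- b) :+ b)) refl
        where open +-*-Solver

    scale : ∀ B → Positive B → ∀ ε → 0ℚ ℚ.< ε → ∃[ δ ] 0ℚ ℚ.< δ × B ℚ.* δ ≡ ε
    scale B B>0 ε 0<ε =
        B⁻¹ ℚ.* ε
      , subst (ℚ._< B⁻¹ ℚ.* ε) (ℚ.*-zeroʳ B⁻¹)
          (ℚ.*-monoʳ-<-pos B⁻¹ {{ℚ.1/pos⇒pos B {{B>0}}}} 0<ε)
      , trans (sym (ℚ.*-assoc B B⁻¹ ε))
          (trans (cong (ℚ._* ε) (ℚ.*-inverseʳ B {{ℚ.pos⇒nonZero B {{B>0}}}})) (ℚ.*-identityˡ ε))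
      where
      B⁻¹ : ℚ
      B⁻¹ = (1/ B) {{ℚ.pos⇒nonZero B {{B>0}}}}

    *-mono-abs : ∀ {a b B δ} → Positive B → ℚ.∣ a ∣ ℚ.≤ B → ℚ.∣ b ∣ ℚ.≤ δ →
      ℚ.∣ a ℚ.* b ∣ ℚ.≤ B ℚ.* δ
    *-mono-abs {a} {b} {B} {δ} B>0 a≤ b≤ = begin
        ℚ.∣ a ℚ.* b ∣            ≡⟨ ℚ.∣p*q∣≡∣p∣*∣q∣ a b ⟩
        ℚ.∣ a ∣ ℚ.* ℚ.∣ b ∣      ≤⟨ ℚ.*-monoʳ-≤-nonNeg ℚ.∣ b ∣ {{ℚ.∣-∣-nonNeg b}} a≤ ⟩
        B ℚ.* ℚ.∣ b ∣            ≤⟨ ℚ.*-monoˡ-≤-nonNeg B {{ℚ.pos⇒nonNeg B {{B>0}}}} b≤ ⟩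
        B ℚ.* δ                  ∎
      where open ℚ.≤-Reasoning

    *-estimate : ∀ a b c d B C δ η → Positive B → Positive C →
      ℚ.∣ a ∣ ℚ.≤ B → ℚ.∣ d ∣ ℚ.≤ C → ℚ.∣ b ℚ.- d ∣ ℚ.≤ δ → ℚ.∣ a ℚ.- c ∣ ℚ.≤ η →
      ℚ.∣ a ℚ.* b ℚ.- c ℚ.* d ∣ ℚ.≤ B ℚ.* δ ℚ.+ C ℚ.* η
    *-estimate a b c d B C δ η B>0 C>0 a≤ d≤ b-d≤ a-c≤ = begin
        ℚ.∣ a ℚ.* b ℚ.- c ℚ.* d ∣
          ≡⟨ cong ℚ.∣_∣ (rearrange a b c d) ⟩
        ℚ.∣ a ℚ.* (b ℚ.- d) ℚ.+ d ℚ.* (a ℚ.- c) ∣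
          ≤⟨ ℚ.∣p+q∣≤∣p∣+∣q∣ (a ℚ.* (b ℚ.- d)) (d ℚ.* (a ℚ.- c)) ⟩
        ℚ.∣ a ℚ.* (b ℚ.- d) ∣ ℚ.+ ℚ.∣ d ℚ.* (a ℚ.- c) ∣
          ≤⟨ ℚ.+-mono-≤ (*-mono-abs {a} {b ℚ.- d} {B} {δ} B>0 a≤ b-d≤)
                        (*-mono-abs {d} {a ℚ.- c} {C} {η} C>0 d≤ a-c≤) ⟩
        B ℚ.* δ ℚ.+ C ℚ.* η ∎
      where
      open ℚ.≤-Reasoning
      rearrange : ∀ a b c d → a ℚ.* b ℚ.- c ℚ.* d ≡ a ℚ.* (b ℚ.- d) ℚ.+ d ℚ.* (a ℚ.- c)
      rearrange = +-*-Solver.solve 4 (λ a b c d →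
        (a :* b :- c :* d) := (a :* (b :- d) :+ d :* (a :- c))) refl
        where open +-*-Solver

    cauchy-* : ∀ {x y} → IsCauchy x → IsCauchy y → IsCauchy (λ n → x n ℚ.* y n)
    cauchy-* {x} {y} cx cy ε 0<ε =
      let B , B>0 , K , x≤B = bounded {x} cx
          C , C>0 , L , y≤C = bounded {y} cy
          δ , 0<δ , Bδ = scale B B>0 (½ ℚ.* ε) (0<½ε 0<ε)
          η , 0<η , Cη = scale C C>0 (½ ℚ.* ε) (0<½ε 0<ε)
          M , hy = cy δ 0<δ
          N , hx = cx η 0<η
      in (K ℕ.⊔ L) ℕ.⊔ (M ℕ.⊔ N) , λ m n m≥ n≥ →
      let m≥KL = ℕ.m⊔n≤o⇒m≤o (K ℕ.⊔ L) (M ℕ.⊔ N) m≥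
          n≥KL = ℕ.m⊔n≤o⇒m≤o (K ℕ.⊔ L) (M ℕ.⊔ N) n≥
          m≥MN = ℕ.m⊔n≤o⇒n≤o (K ℕ.⊔ L) (M ℕ.⊔ N) m≥
          n≥MN = ℕ.m⊔n≤o⇒n≤o (K ℕ.⊔ L) (M ℕ.⊔ N) n≥
      in subst (ℚ.∣ x m ℚ.* y m ℚ.- x n ℚ.* y n ∣ ℚ.≤_)
           (trans (cong₂ ℚ._+_ Bδ Cη) (½ε+½ε ε))
           (*-estimate (x m) (y m) (x n) (y n) B C δ η B>0 C>0
             (x≤B m (ℕ.m⊔n≤o⇒m≤o K L m≥KL))
             (y≤C n (ℕ.m⊔n≤o⇒n≤o K L n≥KL))
             (hy m n (ℕ.m⊔n≤o⇒m≤o M N m≥MN) (ℕ.m⊔n≤o⇒m≤o M N n≥MN))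
             (hx m n (ℕ.m⊔n≤o⇒n≤o M N m≥MN) (ℕ.m⊔n≤o⇒n≤o M N n≥MN)))

fromℚ : ℚ → ℝ
fromℚ q = mkℝ (λ _ → q) (cauchy-const q)

fromℕ : ℕ → ℝ
fromℕ n = fromℚ (+ n / 1)

0ℝ 1ℝ ½ℝ : ℝ
0ℝ = fromℚ 0ℚ
1ℝ = fromℚ 1ℚ
½ℝ = fromℚ ½

infixl 6 _+_ _-_
infixl 7 _*_
infix  8 -_

_+_ : ℝ → ℝ → ℝ
mkℝ x cx + mkℝ y cy = mkℝ (λ n → x n ℚ.+ y n) (cauchy-+ {x} {y} cx cy)

-_ : ℝ → ℝ
- mkℝ x cx = mkℝ (λ n → ℚ.- x n) (cauchy-neg {x} cx)

_-_ : ℝ → ℝ → ℝ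
x - y = x + (- y)

_*_ : ℝ → ℝ → ℝ
mkℝ x cx * mkℝ y cy = mkℝ (λ n → x n ℚ.* y n) (cauchy-* {x} {y} cx cy)

infix 4 _IsCeilingOf_

-- m = ⌈x⌉. A relation rather than a function, since the ceiling of a
-- real is not computable.
_IsCeilingOf_ : ℕ → ℝ → Set
m IsCeilingOf x = x ≤ fromℕ m × fromℕ m < x + 1ℝ

infix 4 _⟶_

_⟶_ : (ℕ → ℝ) → ℝ → Set
f ⟶ L = ∀ ε → 0ℝ < ε → ∃[ N ] (∀ n → N ℕ.≤ n → L - ε < f n × f n < L + ε)

IsΩ[n] : (ℕ → ℝ) → Set
IsΩ[n] g = ∃[ c ] 0ℝ < c × ∃[ N ] (∀ n → N ℕ.≤ n → c * fromℕ n ≤ g n)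

------------------------------------------------------------------------
-- Finite probability distributions, as lists of weighted outcomes. The
-- same outcome may be listed several times; its weights then add up.

Dist : Set → Set
Dist A = List (A × ℝ)

return : ∀ {A} → A → Dist A
return a = [ (a , 1ℝ) ]

_>>=_ : ∀ {A B} → Dist A → (A → Dist B) → Dist B
μ >>= f = concatMap (λ (a , w) → map (map₂ (w *_)) (f a)) μ

bernoulli : ℝ → Dist Bool
bernoulli p = (true , p) ∷ (false , 1ℝ - p) ∷ []

-- There is no uniform distribution on an empty list; the first clause is
-- a dummy value.
uniform : ∀ {A} → List A → Dist A
uniform []           = []
uniform xs@(_ ∷ _) = map (λ x → x , fromℚ (+ 1 / length xs)) xs

iid : ∀ {A} (m : ℕ) → Dist A → Dist (Vec A m)
iid zero    μ = return []
iid (suc m) μ = do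
  x  ← μ
  xs ← iid m μ
  return (x ∷ xs)

-- The value does not depend on the decision procedure chosen for E.
Pr : ∀ {A} → Dist A → {E : Pred A 0ℓ} → Decidable E → ℝ
Pr μ E? = foldr (λ (a , w) t → (if does (E? a) then w else 0ℝ) + t) 0ℝ μ

-- Deciding the events is what makes their probabilities definable as
-- finite sums; classically it is no restriction.
WithHighProbability : {Ω : ℕ → Set} → (∀ n → Dist (Ω n)) → (∀ n → Pred (Ω n) 0ℓ) → Set
WithHighProbability μ E = ∃ λ (E? : ∀ n → Decidable (E n)) → (λ n → Pr (μ n) (E? n)) ⟶ 1ℝ

------------------------------------------------------------------------
-- CNF-XOR formulas

Assignment : ℕ → Set
Assignment n = Vec Bool n

-- The entry at i is  just true  for the literal Xᵢ,  just false  for the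
-- literal ¬Xᵢ, and  nothing  when Xᵢ does not occur.
Clause : ℕ → Set
Clause n = Vec (Maybe Bool) n

clauseVars : ∀ {n} → Clause n → Subset n
clauseVars = Vec.map is-just

-- All vectors over the given alphabet, each listed once if the alphabet
-- has no repetitions.
vectors : ∀ {A : Set} → List A → (n : ℕ) → List (Vec A n)
vectors as zero    = [ [] ]
vectors as (suc n) = cartesianProductWith _∷_ as (vectors as n)

kClauses : (k n : ℕ) → List (Clause n)
kClauses k n =
  filter (λ C → ∣ clauseVars C ∣ ℕ.≟ k) (vectors (nothing ∷ just true ∷ just false ∷ []) n)

record XorClause (n : ℕ) : Set where
  constructor xorClause
  field
    constant : Bool
    vars     : Subset n

randomXorClause : ℝ → (n : ℕ) → Dist (XorClause n)
randomXorClause p n = do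
  S ← iid n (bernoulli p)
  b ← bernoulli ½ℝ
  return (xorClause b S)

Formula : (n m l : ℕ) → Set
Formula n m l = Vec (Clause n) m × Vec (XorClause n) l

ψ : (k : ℕ) (p : ℝ) (n m l : ℕ) → Dist (Formula n m l)
ψ k p n m l = do
  Cs ← iid m (uniform (kClauses k n))
  Xs ← iid l (randomXorClause p n)
  return (Cs , Xs)

_⊨ᶜ_ : ∀ {n} → Assignment n → Clause n → Set
σ ⊨ᶜ C = ∃[ i ] lookup C i ≡ just (lookup σ i)

-- The constants 0 and 1 are  false  and  true.
_⊨ˣ_ : ∀ {n} → Assignment n → XorClause n → Set
σ ⊨ˣ xorClause b S = b xor Vec.foldr′ _xor_ false (zipWith _∧_ S σ) ≡ true

_⊨_ : ∀ {n m l} → Assignment n → Formula n m l → Set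
σ ⊨ (Cs , Xs) = All (σ ⊨ᶜ_) Cs × All (σ ⊨ˣ_) Xs

hamming : ∀ {n} → Assignment n → Assignment n → ℕ
hamming σ τ = ∣ zipWith _xor_ σ τ ∣

_-Separated : ℝ → ∀ {n m l} → Formula n m l → Set
(d -Separated) φ = ∀ σ τ → σ ⊨ φ → τ ⊨ φ → σ ≢ τ → d ≤ fromℕ (hamming σ τ)

{-# OPTIONS --safe #-}

-- If σ ≠ τ solve the formula, then x = σ ⊕ τ is a nonzero vector orthogonal to the variable
-- sets of all l = ⌈sn⌉ XOR-clauses. A fixed nonzero x is orthogonal to one random variable set
-- with probability at most q = max(p, 1 - p) < 1. The expected number of such x of weight at
-- most l / L is bounded by weighting x with u^∣x∣ z⁻ˡ, where u = zᴸ: it is at most (1 + u)ⁿ (q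
-- / z)ˡ, and since n ≤ M l for a constant M, this is at most zˡ → 0 once z < 1 is close to 1
-- and (1 + u)ᴹ q ≤ z². The k-clauses only need to form a probability distribution.
--
-- A real is a Cauchy sequence and operations act termwise, so the whole argument is carried
-- out over ℚ for the j-th approximations of all weights, for every large j.

module Submission where

open import Algebra.Bundles using (CommutativeRing)
open import Data.Bool using (Bool; true; false; not; _∧_; _xor_; if_then_else_)
import Data.Bool.Properties as Bool
import Data.Fin.Properties as Fin
open import Data.Fin.Subset using (Subset; ∣_∣)
open import Data.Integer using (+_)
import Data.Integer as ℤ
import Data.Integer.Properties as ℤ
open import Data.List using (List; []; _∷_; map; _++_; foldr; length)
open import Data.List.Membership.Propositional using (_∈_)
open import Data.List.Membership.Propositional.Properties using (∈-cartesianProductWith⁺; ∈-filter⁺)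
import Data.List.Relation.Unary.All as List
open import Data.List.Relation.Unary.Any using (here; there)
open import Data.Maybe using (Maybe; nothing; just)
import Data.Maybe.Properties as Maybe
open import Data.Nat using (ℕ; zero; suc; NonZero)
import Data.Nat as ℕ
import Data.Nat.Properties as ℕ
open import Data.Product using (∃-syntax; _×_; _,_; proj₁; proj₂; map₂)
open import Data.Rational using (ℚ; 0ℚ; 1ℚ; ½; _/_; 1/_; mkℚ; toℚᵘ)
import Data.Rational as ℚ
import Data.Rational.Properties as ℚ
open import Data.Rational.Solver using (module +-*-Solver)
import Data.Rational.Unnormalised as ℚᵘ
import Data.Rational.Unnormalised.Properties as ℚᵘ
open import Data.Sum using ([_,_]′)
open import Data.Vec using (Vec; []; _∷_; lookup; zipWith)
import Data.Vec as Vec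
import Data.Vec.Properties as Vec
open import Data.Vec.Relation.Unary.All using (All; []; _∷_)
import Data.Vec.Relation.Unary.All as All
open import Relation.Binary.PropositionalEquality
  using (_≡_; _≢_; refl; sym; trans; cong; cong₂; subst; subst₂; module ≡-Reasoning)
open import Relation.Nullary using (Dec; yes; no; ¬_; contradiction; does; map′; _×-dec_; _→-dec_; ¬?)
open import Relation.Nullary.Decidable using (toWitness)
open import Relation.Unary using (Pred; Decidable)

open import Algebra.Properties.CommutativeSemiring.Exp
  (CommutativeRing.commutativeSemiring ℚ.+-*-commutativeRing)
  using (_^_; ^-assocʳ; ^-distrib-*)
open +-*-Solver using (solve; _:+_; _:*_; _:-_; _:=_; con)

open import Defs

-- Rational arithmetic

p+d≡q⇒p≤q : ∀ {p q} d → 0ℚ ℚ.≤ d → p ℚ.+ d ≡ q → p ℚ.≤ q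
p+d≡q⇒p≤q {p} d 0≤d refl = subst (ℚ._≤ p ℚ.+ d) (ℚ.+-identityʳ p) (ℚ.+-monoʳ-≤ p 0≤d)

p≤q⇒0≤q-p : ∀ {p q} → p ℚ.≤ q → 0ℚ ℚ.≤ q ℚ.- p
p≤q⇒0≤q-p {p} {q} p≤q = subst (ℚ._≤ q ℚ.- p) (ℚ.+-inverseʳ p) (ℚ.+-monoˡ-≤ (ℚ.- p) p≤q)

*-monoˡ-≤ : ∀ {r p q} → 0ℚ ℚ.≤ r → p ℚ.≤ q → r ℚ.* p ℚ.≤ r ℚ.* q
*-monoˡ-≤ {r} 0≤r = ℚ.*-monoˡ-≤-nonNeg r {{ℚ.nonNegative 0≤r}}

*-monoʳ-≤ : ∀ {r p q} → 0ℚ ℚ.≤ r → p ℚ.≤ q → p ℚ.* r ℚ.≤ q ℚ.* r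
*-monoʳ-≤ {r} 0≤r = ℚ.*-monoʳ-≤-nonNeg r {{ℚ.nonNegative 0≤r}}

*-mono-≤ : ∀ {p q r s} → 0ℚ ℚ.≤ q → 0ℚ ℚ.≤ r → p ℚ.≤ q → r ℚ.≤ s → p ℚ.* r ℚ.≤ q ℚ.* s
*-mono-≤ 0≤q 0≤r p≤q r≤s = ℚ.≤-trans (*-monoʳ-≤ 0≤r p≤q) (*-monoˡ-≤ 0≤q r≤s)

+-nonNeg : ∀ {p q} → 0ℚ ℚ.≤ p → 0ℚ ℚ.≤ q → 0ℚ ℚ.≤ p ℚ.+ q
+-nonNeg 0≤p 0≤q = ℚ.+-mono-≤ 0≤p 0≤q

*-nonNeg : ∀ {p q} → 0ℚ ℚ.≤ p → 0ℚ ℚ.≤ q → 0ℚ ℚ.≤ p ℚ.* q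
*-nonNeg {p} {q} 0≤p 0≤q = subst (ℚ._≤ p ℚ.* q) (ℚ.*-zeroʳ p) (*-monoˡ-≤ 0≤p 0≤q)

*-pos : ∀ {p q} → 0ℚ ℚ.< p → 0ℚ ℚ.< q → 0ℚ ℚ.< p ℚ.* q
*-pos {p} {q} 0<p 0<q =
  subst (ℚ._< p ℚ.* q) (ℚ.*-zeroʳ p) (ℚ.*-monoʳ-<-pos p {{ℚ.positive 0<p}} 0<q)

0≤1 : 0ℚ ℚ.≤ 1ℚ
0≤1 = ℚ.nonNegative⁻¹ 1ℚ

½p+½p≡p : ∀ p → ½ ℚ.* p ℚ.+ ½ ℚ.* p ≡ p
½p+½p≡p p = trans (sym (ℚ.*-distribʳ-+ p ½ ½)) (ℚ.*-identityˡ p)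

-- The order on reals compares only up to every positive `ε`; this recovers an exact rational
-- inequality. If it failed, a rational `m` strictly between `q` and `p` would contradict the
-- hypothesis at `ε = m - q`.
≤-closed : ∀ {p q} → (∀ ε → 0ℚ ℚ.< ε → p ℚ.≤ q ℚ.+ ε) → p ℚ.≤ q
≤-closed {p} {q} h with p ℚ.≤? q
... | yes p≤q = p≤q
... | no  p≰q =
  let m , q<m , m<p = ℚ.<-dense (ℚ.≰⇒> p≰q)
      0<m-q = subst (ℚ._< m ℚ.- q) (ℚ.+-inverseʳ q) (ℚ.+-monoˡ-< (ℚ.- q) q<m)
      p≤m = subst (p ℚ.≤_) (solve 2 (λ q m → q :+ (m :- q) := m) refl q m) (h (m ℚ.- q) 0<m-q)
  in contradiction (ℚ.<-≤-trans m<p p≤m) (ℚ.<-irrefl refl)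

-- Natural numbers among the rationals

ι : ℕ → ℚ
ι n = + n / 1

toℚᵘ-ι : ∀ n → toℚᵘ (ι n) ℚᵘ.≃ ℚᵘ.mkℚᵘ (+ n) 0
toℚᵘ-ι n = ℚ.toℚᵘ-fromℚᵘ (ℚᵘ.mkℚᵘ (+ n) 0)

ι-suc : ∀ n → ι (suc n) ≡ 1ℚ ℚ.+ ι n
ι-suc n = ℚ.toℚᵘ-injective (begin
  toℚᵘ (ι (suc n))                 ≈⟨ toℚᵘ-ι (suc n) ⟩
  ℚᵘ.mkℚᵘ (+ suc n) 0              ≈⟨ ℚᵘ.*≡* (cong (λ i → (+ 1 ℤ.+ i) ℤ.* + 1) (sym (ℤ.*-identityʳ (+ n)))) ⟩
  ℚᵘ.mkℚᵘ (+ 1) 0 ℚᵘ.+ ℚᵘ.mkℚᵘ (+ n) 0 ≈⟨ ℚᵘ.+-congʳ (toℚᵘ 1ℚ) (ℚᵘ.≃-sym (toℚᵘ-ι n)) ⟩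
  toℚᵘ 1ℚ ℚᵘ.+ toℚᵘ (ι n)          ≈⟨ ℚᵘ.≃-sym (ℚ.toℚᵘ-homo-+ 1ℚ (ι n)) ⟩
  toℚᵘ (1ℚ ℚ.+ ι n)                ∎)
  where open ℚᵘ.≃-Reasoning

ι-* : ∀ m n → ι (m ℕ.* n) ≡ ι m ℚ.* ι n
ι-* m n = ℚ.toℚᵘ-injective (begin
  toℚᵘ (ι (m ℕ.* n))               ≈⟨ toℚᵘ-ι (m ℕ.* n) ⟩
  ℚᵘ.mkℚᵘ (+ (m ℕ.* n)) 0          ≈⟨ ℚᵘ.*≡* (cong (ℤ._* + 1) (ℤ.pos-* m n)) ⟩
  ℚᵘ.mkℚᵘ (+ m) 0 ℚᵘ.* ℚᵘ.mkℚᵘ (+ n) 0 ≈⟨ ℚᵘ.*-cong (ℚᵘ.≃-sym (toℚᵘ-ι m)) (ℚᵘ.≃-sym (toℚᵘ-ι n)) ⟩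
  toℚᵘ (ι m) ℚᵘ.* toℚᵘ (ι n)       ≈⟨ ℚᵘ.≃-sym (ℚ.toℚᵘ-homo-* (ι m) (ι n)) ⟩
  toℚᵘ (ι m ℚ.* ι n)               ∎)
  where open ℚᵘ.≃-Reasoning

ι-cancel-≤ : ∀ {m n} → ι m ℚ.≤ ι n → m ℕ.≤ n
ι-cancel-≤ {m} {n} h
  with ℚᵘ.≤-respˡ-≃ (toℚᵘ-ι m) (ℚᵘ.≤-respʳ-≃ (toℚᵘ-ι n) (ℚ.toℚᵘ-mono-≤ h))
... | ℚᵘ.*≤* m*1≤n*1 =
  ℤ.drop‿+≤+ (subst₂ ℤ._≤_ (ℤ.*-identityʳ (+ m)) (ℤ.*-identityʳ (+ n)) m*1≤n*1)

ι-mono-≤ : ∀ {m n} → m ℕ.≤ n → ι m ℚ.≤ ι n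
ι-mono-≤ {m} {n} m≤n = ℚ.toℚᵘ-cancel-≤
  (ℚᵘ.≤-respˡ-≃ (ℚᵘ.≃-sym (toℚᵘ-ι m)) (ℚᵘ.≤-respʳ-≃ (ℚᵘ.≃-sym (toℚᵘ-ι n))
    (ℚᵘ.*≤* (ℤ.*-monoʳ-≤-nonNeg (+ 1) (ℤ.+≤+ m≤n)))))

0≤ι : ∀ n → 0ℚ ℚ.≤ ι n
0≤ι n = ℚ.nonNegative⁻¹ (ι n) {{ℚ.normalize-nonNeg n 1}}

ι*1/n≡1 : ∀ n → ι (suc n) ℚ.* (+ 1 / suc n) ≡ 1ℚ
ι*1/n≡1 n = ℚ.toℚᵘ-injective (begin
  toℚᵘ (ι (suc n) ℚ.* (+ 1 / suc n))          ≈⟨ ℚ.toℚᵘ-homo-* (ι (suc n)) (+ 1 / suc n) ⟩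
  toℚᵘ (ι (suc n)) ℚᵘ.* toℚᵘ (+ 1 / suc n)    ≈⟨ ℚᵘ.*-cong (toℚᵘ-ι (suc n)) (ℚ.toℚᵘ-fromℚᵘ (ℚᵘ.mkℚᵘ (+ 1) n)) ⟩
  ℚᵘ.mkℚᵘ (+ suc n) 0 ℚᵘ.* ℚᵘ.mkℚᵘ (+ 1) n    ≈⟨ ℚᵘ.*≡* (cong +_ eq) ⟩
  toℚᵘ 1ℚ                                     ∎)
  where
  open ℚᵘ.≃-Reasoning
  eq : suc n ℕ.* 1 ℕ.* 1 ≡ suc (n ℕ.+ 0 ℕ.+ 0)
  eq = trans (trans (ℕ.*-identityʳ _) (ℕ.*-identityʳ _))
         (cong suc (sym (trans (ℕ.+-identityʳ _) (ℕ.+-identityʳ _))))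

-- A positive rational has numerator at least 1, so multiplying it by its own denominator `suc d`
-- already reaches 1.
archimedean : ∀ {ε} → 0ℚ ℚ.< ε → ∃[ M ] 1ℚ ℚ.≤ ε ℚ.* ι (suc M)
archimedean {ε@(mkℚ (+ suc n) d _)} _ = d , ℚ.toℚᵘ-cancel-≤
  (ℚᵘ.≤-respʳ-≃ (ℚᵘ.≃-sym (ℚᵘ.≃-trans (ℚ.toℚᵘ-homo-* ε (ι (suc d)))
                            (ℚᵘ.*-congˡ {toℚᵘ ε} (toℚᵘ-ι (suc d)))))
    (ℚᵘ.*≤* (ℤ.+≤+ (subst₂ ℕ._≤_ (eq₁ d) (sym (ℕ.*-identityʳ _)) (ℕ.m≤m+n (suc d) (n ℕ.* suc d))))))
  where
  eq₁ : ∀ d → suc d ≡ suc (d ℕ.* 1 ℕ.+ 0)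
  eq₁ d = cong suc (sym (trans (ℕ.+-identityʳ _) (ℕ.*-identityʳ d)))
archimedean {mkℚ (+ zero) _ _}  0<ε = contradiction (ℚ.drop-*<* 0<ε) (ℤ.<-irrefl refl)
archimedean {mkℚ ℤ.-[1+ _ ] _ _} 0<ε with () ← ℚ.drop-*<* 0<ε

-- Powers: monotonicity, decay and growth near 1

^-nonNeg : ∀ {x} n → 0ℚ ℚ.≤ x → 0ℚ ℚ.≤ x ^ n
^-nonNeg zero    0≤x = 0≤1
^-nonNeg (suc n) 0≤x = *-nonNeg 0≤x (^-nonNeg n 0≤x)

^-pos : ∀ {x} n → 0ℚ ℚ.< x → 0ℚ ℚ.< x ^ n
^-pos zero    0<x = ℚ.positive⁻¹ 1ℚ
^-pos (suc n) 0<x = *-pos 0<x (^-pos n 0<x)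

^-monoˡ-≤ : ∀ {x y} n → 0ℚ ℚ.≤ x → x ℚ.≤ y → x ^ n ℚ.≤ y ^ n
^-monoˡ-≤ zero    0≤x x≤y = ℚ.≤-refl
^-monoˡ-≤ (suc n) 0≤x x≤y =
  *-mono-≤ (ℚ.≤-trans 0≤x x≤y) (^-nonNeg n 0≤x) x≤y (^-monoˡ-≤ n 0≤x x≤y)

x≤1⇒x^n≤1 : ∀ {x} n → 0ℚ ℚ.≤ x → x ℚ.≤ 1ℚ → x ^ n ℚ.≤ 1ℚ
x≤1⇒x^n≤1 zero    0≤x x≤1 = ℚ.≤-refl
x≤1⇒x^n≤1 (suc n) 0≤x x≤1 = *-mono-≤ 0≤1 (^-nonNeg n 0≤x) x≤1 (x≤1⇒x^n≤1 n 0≤x x≤1)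

^-antimonoʳ-≤ : ∀ {x m n} → 0ℚ ℚ.≤ x → x ℚ.≤ 1ℚ → m ℕ.≤ n → x ^ n ℚ.≤ x ^ m
^-antimonoʳ-≤ {n = n} 0≤x x≤1 ℕ.z≤n       = x≤1⇒x^n≤1 n 0≤x x≤1
^-antimonoʳ-≤         0≤x x≤1 (ℕ.s≤s m≤n) = *-monoˡ-≤ 0≤x (^-antimonoʳ-≤ 0≤x x≤1 m≤n)

^-monoʳ-≤ : ∀ {x m n} → 1ℚ ℚ.≤ x → m ℕ.≤ n → x ^ m ℚ.≤ x ^ n
^-monoʳ-≤ {n = zero}  1≤x ℕ.z≤n = ℚ.≤-refl
^-monoʳ-≤ {n = suc n} 1≤x ℕ.z≤n =
  *-mono-≤ (ℚ.≤-trans 0≤1 1≤x) 0≤1 1≤x (^-monoʳ-≤ {n = n} 1≤x ℕ.z≤n)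
^-monoʳ-≤             1≤x (ℕ.s≤s m≤n) = *-monoˡ-≤ (ℚ.≤-trans 0≤1 1≤x) (^-monoʳ-≤ 1≤x m≤n)

-- A division-free Bernoulli inequality. The induction rests on (1 - η)(1 + (n + 1)η) = 1 + nη - (n
-- + 1)η².
z^n[1+nη]≤1 : ∀ {z η} n → 0ℚ ℚ.≤ z → 0ℚ ℚ.≤ η → z ≡ 1ℚ ℚ.- η → z ^ n ℚ.* (1ℚ ℚ.+ ι n ℚ.* η) ℚ.≤ 1ℚ
z^n[1+nη]≤1 {z} {η} zero    _   _   _ = ℚ.≤-reflexive
  (solve 1 (λ η → con 1ℚ :* (con 1ℚ :+ con 0ℚ :* η) := con 1ℚ) refl η)
z^n[1+nη]≤1 {z} {η} (suc n) 0≤z 0≤η refl = begin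
  z ℚ.* z ^ n ℚ.* (1ℚ ℚ.+ ι (suc n) ℚ.* η)
    ≡⟨ cong (λ m → z ℚ.* z ^ n ℚ.* (1ℚ ℚ.+ m ℚ.* η)) (ι-suc n) ⟩
  z ℚ.* z ^ n ℚ.* (1ℚ ℚ.+ (1ℚ ℚ.+ ι n) ℚ.* η)
    ≤⟨ p+d≡q⇒p≤q (z ^ n ℚ.* (η ℚ.* η ℚ.* (1ℚ ℚ.+ ι n)))
         (*-nonNeg (^-nonNeg n 0≤z) (*-nonNeg (*-nonNeg 0≤η 0≤η) (+-nonNeg 0≤1 (0≤ι n))))
         (solve 3 (λ η w m → (con 1ℚ :- η) :* w :* (con 1ℚ :+ (con 1ℚ :+ m) :* η)
                              :+ w :* (η :* η :* (con 1ℚ :+ m))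
                            := w :* (con 1ℚ :+ m :* η)) refl η (z ^ n) (ι n)) ⟩
  z ^ n ℚ.* (1ℚ ℚ.+ ι n ℚ.* η)
    ≤⟨ z^n[1+nη]≤1 n 0≤z 0≤η refl ⟩
  1ℚ ∎
  where open ℚ.≤-Reasoning

-- The previous bound gives zᵐ · mη ≤ 1, so any m with εηm ≥ 1 serves as exponent.
powers-vanish : ∀ {z η ε} → 0ℚ ℚ.≤ z → 0ℚ ℚ.< η → z ≡ 1ℚ ℚ.- η → 0ℚ ℚ.< ε → ∃[ n ] z ^ suc n ℚ.≤ ε
powers-vanish {z} {η} {ε} 0≤z 0<η z≡ 0<ε with archimedean (*-pos 0<ε 0<η)
... | n , 1≤εηn = n , (begin
  w                        ≡⟨ sym (ℚ.*-identityʳ w) ⟩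
  w ℚ.* 1ℚ                 ≤⟨ *-monoˡ-≤ 0≤w 1≤εηn ⟩
  w ℚ.* (ε ℚ.* η ℚ.* m)
    ≤⟨ p+d≡q⇒p≤q (ε ℚ.* w) (*-nonNeg (ℚ.<⇒≤ 0<ε) 0≤w)
         (solve 4 (λ w ε η m → w :* (ε :* η :* m) :+ ε :* w := ε :* (w :* (con 1ℚ :+ m :* η))) refl w ε η m) ⟩
  ε ℚ.* (w ℚ.* (1ℚ ℚ.+ m ℚ.* η))
    ≤⟨ *-monoˡ-≤ (ℚ.<⇒≤ 0<ε) (z^n[1+nη]≤1 (suc n) 0≤z (ℚ.<⇒≤ 0<η) z≡) ⟩
  ε ℚ.* 1ℚ                 ≡⟨ ℚ.*-identityʳ ε ⟩
  ε                        ∎)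
  where
  open ℚ.≤-Reasoning
  w = z ^ suc n
  m = ι (suc n)
  0≤w = ^-nonNeg (suc n) 0≤z

-- Since u² ≤ u on the unit interval, one more factor 1 + u turns the constant `C` into at most 2C +
-- 1.
[1+u]^M≤1+Cu : ∀ M → ∃[ C ] 0ℚ ℚ.< C × (∀ u → 0ℚ ℚ.≤ u → u ℚ.≤ 1ℚ → (1ℚ ℚ.+ u) ^ M ℚ.≤ 1ℚ ℚ.+ C ℚ.* u)
-- The constant starts at 1 rather than 0: it must be positive, because it is inverted later.
[1+u]^M≤1+Cu zero = 1ℚ , ℚ.positive⁻¹ 1ℚ , λ u 0≤u _ →
  p+d≡q⇒p≤q u 0≤u (cong (1ℚ ℚ.+_) (sym (ℚ.*-identityˡ u)))
[1+u]^M≤1+Cu (suc M) with [1+u]^M≤1+Cu M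
... | C , 0<C , h = C ℚ.+ C ℚ.+ 1ℚ , ℚ.+-mono-<-≤ (ℚ.+-mono-< 0<C 0<C) 0≤1 , λ u 0≤u u≤1 → begin
  (1ℚ ℚ.+ u) ℚ.* (1ℚ ℚ.+ u) ^ M
    ≤⟨ *-monoˡ-≤ (+-nonNeg 0≤1 0≤u) (h u 0≤u u≤1) ⟩
  (1ℚ ℚ.+ u) ℚ.* (1ℚ ℚ.+ C ℚ.* u)
    ≤⟨ p+d≡q⇒p≤q (C ℚ.* u ℚ.* (1ℚ ℚ.- u)) (*-nonNeg (*-nonNeg (ℚ.<⇒≤ 0<C) 0≤u) (p≤q⇒0≤q-p u≤1))
         (solve 2 (λ C u → (con 1ℚ :+ u) :* (con 1ℚ :+ C :* u) :+ C :* u :* (con 1ℚ :- u)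
                        := con 1ℚ :+ (C :+ C :+ con 1ℚ) :* u) refl C u) ⟩
  1ℚ ℚ.+ (C ℚ.+ C ℚ.+ 1ℚ) ℚ.* u ∎
  where open ℚ.≤-Reasoning

-- For u small enough, (1 + u)ᴹ ≤ 1 + 2η, and (1 - 4η)(1 + 2η) ≤ (1 - η)².
∃-chernoff-exponent : ∀ {z η} M → 0ℚ ℚ.≤ z → 0ℚ ℚ.< η → z ≡ 1ℚ ℚ.- η → 0ℚ ℚ.≤ 1ℚ ℚ.- (η ℚ.+ η ℚ.+ (η ℚ.+ η)) →
  ∃[ L ] (1ℚ ℚ.+ z ^ suc L) ^ M ℚ.* (1ℚ ℚ.- (η ℚ.+ η ℚ.+ (η ℚ.+ η))) ℚ.≤ z ℚ.* z
∃-chernoff-exponent {z} {η} M 0≤z 0<η refl 0≤q with [1+u]^M≤1+Cu M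
... | C , 0<C , h = L , (begin
  (1ℚ ℚ.+ u) ^ M ℚ.* q            ≤⟨ *-monoʳ-≤ 0≤q (h u (^-nonNeg (suc L) 0≤z) u≤1) ⟩
  (1ℚ ℚ.+ C ℚ.* u) ℚ.* q          ≤⟨ *-monoʳ-≤ 0≤q (ℚ.+-monoʳ-≤ 1ℚ Cu≤2η) ⟩
  (1ℚ ℚ.+ (η ℚ.+ η)) ℚ.* q
    ≤⟨ p+d≡q⇒p≤q (9η² η) (0≤9η² η (ℚ.<⇒≤ 0<η))
        (solve 1 (λ η → (con 1ℚ :+ (η :+ η)) :* (con 1ℚ :- (η :+ η :+ (η :+ η)))
                    :+ (η :* η :+ (η :+ η) :* (η :+ η :+ (η :+ η)))
              := (con 1ℚ :- η) :* (con 1ℚ :- η)) refl η) ⟩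
  z ℚ.* z                         ∎)
  where
  open ℚ.≤-Reasoning
  q = 1ℚ ℚ.- (η ℚ.+ η ℚ.+ (η ℚ.+ η))
  instance
    C-pos = ℚ.positive 0<C
    C≢0 = ℚ.pos⇒nonZero C
  ε = 1/ C ℚ.* (η ℚ.+ η)
  0<ε : 0ℚ ℚ.< ε
  0<ε = *-pos (ℚ.positive⁻¹ (1/ C) {{ℚ.1/pos⇒pos C}}) (ℚ.+-mono-< 0<η 0<η)
  vanish = powers-vanish 0≤z 0<η refl 0<ε
  L = proj₁ vanish
  u = z ^ suc L
  u≤1 : u ℚ.≤ 1ℚ
  u≤1 = x≤1⇒x^n≤1 (suc L) 0≤z (p+d≡q⇒p≤q η (ℚ.<⇒≤ 0<η) (solve 1 (λ η → con 1ℚ :- η :+ η := con 1ℚ) refl η))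
  Cu≤2η : C ℚ.* u ℚ.≤ η ℚ.+ η
  Cu≤2η = begin
    C ℚ.* u                     ≤⟨ *-monoˡ-≤ (ℚ.<⇒≤ 0<C) (proj₂ vanish) ⟩
    C ℚ.* (1/ C ℚ.* (η ℚ.+ η))  ≡⟨ sym (ℚ.*-assoc C (1/ C) (η ℚ.+ η)) ⟩
    C ℚ.* 1/ C ℚ.* (η ℚ.+ η)    ≡⟨ cong (ℚ._* (η ℚ.+ η)) (ℚ.*-inverseʳ C) ⟩
    1ℚ ℚ.* (η ℚ.+ η)            ≡⟨ ℚ.*-identityˡ (η ℚ.+ η) ⟩
    η ℚ.+ η                     ∎
  9η² : ℚ → ℚ
  9η² η = η ℚ.* η ℚ.+ (η ℚ.+ η) ℚ.* (η ℚ.+ η ℚ.+ (η ℚ.+ η))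
  0≤9η² : ∀ η → 0ℚ ℚ.≤ η → 0ℚ ℚ.≤ 9η² η
  0≤9η² η 0≤η = +-nonNeg (*-nonNeg 0≤η 0≤η)
    (*-nonNeg (+-nonNeg 0≤η 0≤η) (+-nonNeg (+-nonNeg 0≤η 0≤η) (+-nonNeg 0≤η 0≤η)))

-- Expectations

𝟙 : Bool → ℚ
𝟙 b = if b then 1ℚ else 0ℚ

∏ : ∀ {A : Set} {m} → (A → ℚ) → Vec A m → ℚ
∏ f []       = 1ℚ
∏ f (x ∷ xs) = f x ℚ.* ∏ f xs

0≤𝟙 : ∀ b → 0ℚ ℚ.≤ 𝟙 b
0≤𝟙 true  = 0≤1
0≤𝟙 false = ℚ.≤-refl

∏-nonNeg : ∀ {A : Set} {m} {f : A → ℚ} → (∀ a → 0ℚ ℚ.≤ f a) → (xs : Vec A m) → 0ℚ ℚ.≤ ∏ f xs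
∏-nonNeg 0≤f []       = 0≤1
∏-nonNeg 0≤f (x ∷ xs) = *-nonNeg (0≤f x) (∏-nonNeg 0≤f xs)

-- Expectation with every real weight replaced by its j-th rational approximation.
𝔼 : ∀ {A} → ℕ → Dist A → (A → ℚ) → ℚ
𝔼 j μ f = foldr (λ (a , w) t → seq w j ℚ.* f a ℚ.+ t) 0ℚ μ

-- Real addition is termwise, so a probability can be bounded one approximation at a time, as the
-- expectation of an indicator.
seq-Pr : ∀ {A} j (μ : Dist A) {E : Pred A _} (E? : Decidable E) →
  seq (Pr μ E?) j ≡ 𝔼 j μ (λ a → 𝟙 (does (E? a)))
seq-Pr j []            E? = refl
seq-Pr j ((a , w) ∷ μ) E? = cong₂ ℚ._+_ (weight (does (E? a))) (seq-Pr j μ E?)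
  where
  weight : ∀ b → seq (if b then w else 0ℝ) j ≡ seq w j ℚ.* 𝟙 b
  weight true  = sym (ℚ.*-identityʳ (seq w j))
  weight false = sym (ℚ.*-zeroʳ (seq w j))

module _ (j : ℕ) where

  𝔼-cong : ∀ {A} (μ : Dist A) {f g} → (∀ a → f a ≡ g a) → 𝔼 j μ f ≡ 𝔼 j μ g
  𝔼-cong []            f≗g = refl
  𝔼-cong ((a , w) ∷ μ) f≗g = cong₂ ℚ._+_ (cong (seq w j ℚ.*_) (f≗g a)) (𝔼-cong μ f≗g)

  𝔼-+ : ∀ {A} (μ : Dist A) f g → 𝔼 j μ (λ a → f a ℚ.+ g a) ≡ 𝔼 j μ f ℚ.+ 𝔼 j μ g
  𝔼-+ []            f g = refl
  𝔼-+ ((a , w) ∷ μ) f g = trans (cong (seq w j ℚ.* (f a ℚ.+ g a) ℚ.+_) (𝔼-+ μ f g))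
    (solve 5 (λ w x y s t → w :* (x :+ y) :+ (s :+ t) := w :* x :+ s :+ (w :* y :+ t)) refl
      (seq w j) (f a) (g a) (𝔼 j μ f) (𝔼 j μ g))

  𝔼-*ˡ : ∀ {A} (μ : Dist A) c f → 𝔼 j μ (λ a → c ℚ.* f a) ≡ c ℚ.* 𝔼 j μ f
  𝔼-*ˡ []            c f = sym (ℚ.*-zeroʳ c)
  𝔼-*ˡ ((a , w) ∷ μ) c f = trans (cong (seq w j ℚ.* (c ℚ.* f a) ℚ.+_) (𝔼-*ˡ μ c f))
    (solve 4 (λ w c x s → w :* (c :* x) :+ c :* s := c :* (w :* x :+ s)) refl
      (seq w j) c (f a) (𝔼 j μ f))

  𝔼-*ʳ : ∀ {A} (μ : Dist A) f c → 𝔼 j μ (λ a → f a ℚ.* c) ≡ 𝔼 j μ f ℚ.* c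
  𝔼-*ʳ μ f c = trans (𝔼-cong μ (λ a → ℚ.*-comm (f a) c)) (trans (𝔼-*ˡ μ c f) (ℚ.*-comm c _))

  𝔼-return : ∀ {A} (a : A) f → 𝔼 j (return a) f ≡ f a
  𝔼-return a f = trans (ℚ.+-identityʳ _) (ℚ.*-identityˡ (f a))

  𝔼-++ : ∀ {A} (μ ν : Dist A) f → 𝔼 j (μ ++ ν) f ≡ 𝔼 j μ f ℚ.+ 𝔼 j ν f
  𝔼-++ []            ν f = sym (ℚ.+-identityˡ _)
  𝔼-++ ((a , w) ∷ μ) ν f = trans (cong (seq w j ℚ.* f a ℚ.+_) (𝔼-++ μ ν f))
    (sym (ℚ.+-assoc (seq w j ℚ.* f a) (𝔼 j μ f) (𝔼 j ν f)))

  𝔼-scale : ∀ {A} w (μ : Dist A) f →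
    𝔼 j (map (map₂ (w *_)) μ) f ≡ seq w j ℚ.* 𝔼 j μ f
  𝔼-scale w []            f = sym (ℚ.*-zeroʳ (seq w j))
  𝔼-scale w ((a , v) ∷ μ) f = trans (cong (seq w j ℚ.* seq v j ℚ.* f a ℚ.+_) (𝔼-scale w μ f))
    (solve 4 (λ w v x s → w :* v :* x :+ w :* s := w :* (v :* x :+ s)) refl
      (seq w j) (seq v j) (f a) (𝔼 j μ f))

  𝔼->>= : ∀ {A B} (μ : Dist A) (ν : A → Dist B) f → 𝔼 j (μ >>= ν) f ≡ 𝔼 j μ (λ a → 𝔼 j (ν a) f)
  𝔼->>= []            ν f = refl
  𝔼->>= ((a , w) ∷ μ) ν f = trans (𝔼-++ (map (map₂ (w *_)) (ν a)) (μ >>= ν) f)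
    (cong₂ ℚ._+_ (𝔼-scale w (ν a) f) (𝔼->>= μ ν f))

  -- Nonnegativity of the weights is recorded only through its effect, monotonicity of the
  -- expectation. In this form the property passes through `>>=` by `𝔼->>=`, with no inspection of
  -- weight lists.
  record IsProb {A} (μ : Dist A) : Set where
    field
      mono  : ∀ {f g} → (∀ a → f a ℚ.≤ g a) → 𝔼 j μ f ℚ.≤ 𝔼 j μ g
      total : 𝔼 j μ (λ _ → 1ℚ) ≡ 1ℚ

    const : ∀ c → 𝔼 j μ (λ _ → c) ≡ c
    const c = begin
      𝔼 j μ (λ _ → c)          ≡⟨ 𝔼-cong μ (λ _ → sym (ℚ.*-identityʳ c)) ⟩
      𝔼 j μ (λ _ → c ℚ.* 1ℚ)   ≡⟨ 𝔼-*ˡ μ c (λ _ → 1ℚ) ⟩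
      c ℚ.* 𝔼 j μ (λ _ → 1ℚ)   ≡⟨ cong (c ℚ.*_) total ⟩
      c ℚ.* 1ℚ                 ≡⟨ ℚ.*-identityʳ c ⟩
      c                        ∎
      where open ≡-Reasoning

    nonNeg : ∀ {f} → (∀ a → 0ℚ ℚ.≤ f a) → 0ℚ ℚ.≤ 𝔼 j μ f
    nonNeg {f} 0≤f = subst (ℚ._≤ 𝔼 j μ f) (const 0ℚ) (mono 0≤f)

  open IsProb

  return-isProb : ∀ {A} (a : A) → IsProb (return a)
  return-isProb a .mono {f} {g} f≤g =
    subst₂ ℚ._≤_ (sym (𝔼-return a f)) (sym (𝔼-return a g)) (f≤g a)
  return-isProb a .total = refl

  >>=-isProb : ∀ {A B} {μ : Dist A} {ν : A → Dist B} →
    IsProb μ → (∀ a → IsProb (ν a)) → IsProb (μ >>= ν)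
  >>=-isProb {μ = μ} {ν} pμ pν .mono {f} {g} f≤g =
    subst₂ ℚ._≤_ (sym (𝔼->>= μ ν f)) (sym (𝔼->>= μ ν g)) (pμ .mono (λ a → pν a .mono f≤g))
  >>=-isProb {μ = μ} {ν} pμ pν .total =
    trans (𝔼->>= μ ν _) (trans (𝔼-cong μ (λ a → pν a .total)) (pμ .total))

  iid-isProb : ∀ {A} m {μ : Dist A} → IsProb μ → IsProb (iid m μ)
  iid-isProb zero    pμ = return-isProb []
  iid-isProb (suc m) pμ =
    >>=-isProb pμ (λ x → >>=-isProb (iid-isProb m pμ) (λ xs → return-isProb (x ∷ xs)))

  𝔼-bernoulli : ∀ p f → 𝔼 j (bernoulli p) f ≡ seq p j ℚ.* f true ℚ.+ (1ℚ ℚ.- seq p j) ℚ.* f false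
  𝔼-bernoulli p f = cong (seq p j ℚ.* f true ℚ.+_) (ℚ.+-identityʳ _)

  -- Approximations of a real in [0, 1] may leave the interval, so the bounds are required of the
  -- `j`-th one.
  bernoulli-isProb : ∀ p → 0ℚ ℚ.≤ seq p j → 0ℚ ℚ.≤ 1ℚ ℚ.- seq p j → IsProb (bernoulli p)
  bernoulli-isProb p 0≤p 0≤1-p .mono {f} {g} f≤g =
    ℚ.+-mono-≤ (*-monoˡ-≤ 0≤p (f≤g true))
      (ℚ.+-monoˡ-≤ 0ℚ (*-monoˡ-≤ 0≤1-p (f≤g false)))
  bernoulli-isProb p _ _ .total =
    solve 1 (λ x → x :* con 1ℚ :+ ((con 1ℚ :- x) :* con 1ℚ :+ con 0ℚ) := con 1ℚ) refl (seq p j)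

  𝔼-constant-weight : ∀ {A} w (xs : List A) c →
    𝔼 j (map (λ x → x , w) xs) (λ _ → c) ≡ ι (length xs) ℚ.* (seq w j ℚ.* c)
  𝔼-constant-weight w []       c = sym (ℚ.*-zeroˡ (seq w j ℚ.* c))
  𝔼-constant-weight w (x ∷ xs) c = begin
    v ℚ.+ 𝔼 j (map (λ x → x , w) xs) (λ _ → c) ≡⟨ cong (v ℚ.+_) (𝔼-constant-weight w xs c) ⟩
    v ℚ.+ ι (length xs) ℚ.* v
      ≡⟨ solve 2 (λ v l → v :+ l :* v := (con 1ℚ :+ l) :* v) refl v (ι (length xs)) ⟩
    (1ℚ ℚ.+ ι (length xs)) ℚ.* v                ≡⟨ cong (ℚ._* v) (sym (ι-suc (length xs))) ⟩
    ι (suc (length xs)) ℚ.* v                   ∎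
    where
    open ≡-Reasoning
    v = seq w j ℚ.* c

  -- The membership witness excludes the empty list, where `uniform` is a dummy of total mass 0.
  uniform-isProb : ∀ {A} {x : A} (xs : List A) → x ∈ xs → IsProb (uniform xs)
  uniform-isProb xs@(_ ∷ ys) _ .mono = go xs
    where
    w = + 1 / length xs
    go : ∀ zs {f g} → (∀ a → f a ℚ.≤ g a) →
      𝔼 j (map (λ x → x , fromℚ w) zs) f ℚ.≤ 𝔼 j (map (λ x → x , fromℚ w) zs) g
    go []       f≤g = ℚ.≤-refl
    go (z ∷ zs) f≤g = ℚ.+-mono-≤
      (*-monoˡ-≤ (ℚ.nonNegative⁻¹ w {{ℚ.normalize-nonNeg 1 (length xs)}}) (f≤g z)) (go zs f≤g)
  uniform-isProb xs@(_ ∷ ys) _ .total = begin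
    𝔼 j (uniform xs) (λ _ → 1ℚ)          ≡⟨ 𝔼-constant-weight (fromℚ w) xs 1ℚ ⟩
    ι (length xs) ℚ.* (w ℚ.* 1ℚ)          ≡⟨ cong (ι (length xs) ℚ.*_) (ℚ.*-identityʳ w) ⟩
    ι (length xs) ℚ.* w                   ≡⟨ ι*1/n≡1 (length ys) ⟩
    1ℚ                                    ∎
    where
    open ≡-Reasoning
    w = + 1 / length xs

  𝔼-iid-suc : ∀ {A} m (μ : Dist A) f →
    𝔼 j (iid (suc m) μ) f ≡ 𝔼 j μ (λ x → 𝔼 j (iid m μ) (λ xs → f (x ∷ xs)))
  𝔼-iid-suc m μ f = trans (𝔼->>= μ _ f) (𝔼-cong μ (λ x →
    trans (𝔼->>= (iid m μ) (λ xs → return (x ∷ xs)) f)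
      (𝔼-cong (iid m μ) (λ xs → 𝔼-return (x ∷ xs) f))))

  -- Independence: each draw contributes its own factor, and all factors have the same mean.
  𝔼-∏ : ∀ {A} m (μ : Dist A) f → 𝔼 j (iid m μ) (∏ f) ≡ 𝔼 j μ f ^ m
  𝔼-∏ zero    μ f = refl
  𝔼-∏ (suc m) μ f = begin
    𝔼 j (iid (suc m) μ) (∏ f)                              ≡⟨ 𝔼-iid-suc m μ (∏ f) ⟩
    𝔼 j μ (λ x → 𝔼 j (iid m μ) (λ xs → f x ℚ.* ∏ f xs))
      ≡⟨ 𝔼-cong μ (λ x → trans (𝔼-*ˡ (iid m μ) (f x) (∏ f)) (cong (f x ℚ.*_) (𝔼-∏ m μ f))) ⟩
    𝔼 j μ (λ x → f x ℚ.* 𝔼 j μ f ^ m)                      ≡⟨ 𝔼-*ʳ μ f _ ⟩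
    𝔼 j μ f ℚ.* 𝔼 j μ f ^ m                                ∎
    where open ≡-Reasoning

-- Parities of a random variable set

parity : ∀ {n} → Subset n → Assignment n → Bool
parity S σ = Vec.foldr′ _xor_ false (zipWith _∧_ S σ)

infixl 6 _⊕_
_⊕_ : ∀ {n} → Assignment n → Assignment n → Assignment n
_⊕_ = zipWith _xor_

-- For fixed `S` the parity is a linear form over the two-element field.
parity-⊕ : ∀ {n} (S : Subset n) σ τ → parity S (σ ⊕ τ) ≡ parity S σ xor parity S τ
parity-⊕ []          []      []      = refl
parity-⊕ (false ∷ S) (_ ∷ σ) (_ ∷ τ) = parity-⊕ S σ τ
parity-⊕ (true ∷ S)  (a ∷ σ) (b ∷ τ) =
  trans (cong ((a xor b) xor_) (parity-⊕ S σ τ)) (interchange a b (parity S σ) (parity S τ))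
  where
  interchange : ∀ a b c d → (a xor b) xor (c xor d) ≡ (a xor c) xor (b xor d)
  interchange false false c d = refl
  interchange false true  false d = refl
  interchange false true  true d = refl
  interchange true false  false d = refl
  interchange true false  true d = Bool.not-involutive d
  interchange true true  false d = sym (Bool.not-involutive d)
  interchange true true  true d = refl

∣σ⊕τ∣≡0⇒σ≡τ : ∀ {n} (σ τ : Assignment n) → hamming σ τ ≡ 0 → σ ≡ τ
∣σ⊕τ∣≡0⇒σ≡τ []          []          _ = refl
∣σ⊕τ∣≡0⇒σ≡τ (true ∷ σ)  (true ∷ τ)  h = cong (true ∷_) (∣σ⊕τ∣≡0⇒σ≡τ σ τ h)
∣σ⊕τ∣≡0⇒σ≡τ (false ∷ σ) (false ∷ τ) h = cong (false ∷_) (∣σ⊕τ∣≡0⇒σ≡τ σ τ h)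

-- Here `x` is an approximation of the variable-probability. The first two fields make the Bernoulli
-- weights nonnegative; the last two let `q` stand for max(p, 1 - p).
record BiasBound (x q : ℚ) : Set where
  field
    0≤x   : 0ℚ ℚ.≤ x
    0≤1-x : 0ℚ ℚ.≤ 1ℚ ℚ.- x
    x≤q   : x ℚ.≤ q
    1-x≤q : 1ℚ ℚ.- x ℚ.≤ q

-- Conditioning on all but one variable in the support of x gives each parity
-- probability at most q.
parity-bound : ∀ j p {q} → BiasBound (seq p j) q →
  ∀ {n} (x : Assignment n) → ∣ x ∣ ≢ 0 → (g : Bool → ℚ) → (∀ b → 0ℚ ℚ.≤ g b) →
  𝔼 j (iid n (bernoulli p)) (λ S → g (parity S x)) ℚ.≤ q ℚ.* (g true ℚ.+ g false)
parity-bound j p {q} bias = go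
  where
  open BiasBound bias
  open ℚ.≤-Reasoning
  μ : ∀ n → Dist (Subset n)
  μ n = iid n (bernoulli p)
  pμ : ∀ n → IsProb j (μ n)
  pμ n = iid-isProb j n (bernoulli-isProb j p 0≤x 0≤1-x)
  step : ∀ n f → 𝔼 j (μ (suc n)) f
    ≡ seq p j ℚ.* 𝔼 j (μ n) (λ S → f (true ∷ S)) ℚ.+ (1ℚ ℚ.- seq p j) ℚ.* 𝔼 j (μ n) (λ S → f (false ∷ S))
  step n f = trans (𝔼-iid-suc j n (bernoulli p) f) (𝔼-bernoulli j p (λ s → 𝔼 j (μ n) (λ S → f (s ∷ S))))
  go : ∀ {n} (x : Assignment n) → ∣ x ∣ ≢ 0 → (g : Bool → ℚ) → (∀ b → 0ℚ ℚ.≤ g b) →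
    𝔼 j (μ n) (λ S → g (parity S x)) ℚ.≤ q ℚ.* (g true ℚ.+ g false)
  go [] x≢0 = contradiction refl x≢0
  go {suc n} (true ∷ x) _ g 0≤g = begin
    𝔼 j (μ (suc n)) (λ S → g (parity S (true ∷ x)))
      ≡⟨ step n (λ S → g (parity S (true ∷ x))) ⟩
    seq p j ℚ.* A ℚ.+ (1ℚ ℚ.- seq p j) ℚ.* B
      -- Once both weights of the first bit are raised to `q`, the rest of the set no longer
      -- matters: the two values of that bit realise both parities.
      ≤⟨ ℚ.+-mono-≤ (*-monoʳ-≤ (IsProb.nonNeg (pμ n) (λ S → 0≤g (not (parity S x)))) x≤q)
                    (*-monoʳ-≤ (IsProb.nonNeg (pμ n) (λ S → 0≤g (parity S x))) 1-x≤q) ⟩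
    q ℚ.* A ℚ.+ q ℚ.* B
      ≡⟨ ℚ.*-distribˡ-+ q A B ⟨
    q ℚ.* (A ℚ.+ B)
      ≡⟨ cong (q ℚ.*_) (𝔼-+ j (μ n) (λ S → g (not (parity S x))) (λ S → g (parity S x))) ⟨
    q ℚ.* 𝔼 j (μ n) (λ S → g (not (parity S x)) ℚ.+ g (parity S x))
      ≡⟨ cong (q ℚ.*_) (trans (𝔼-cong j (μ n) (λ S → both (parity S x))) (IsProb.const (pμ n) _)) ⟩
    q ℚ.* (g true ℚ.+ g false) ∎
    where
    A = 𝔼 j (μ n) (λ S → g (not (parity S x)))
    B = 𝔼 j (μ n) (λ S → g (parity S x))
    both : ∀ b → g (not b) ℚ.+ g b ≡ g true ℚ.+ g false
    both true  = ℚ.+-comm (g false) (g true)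
    both false = refl
  go {suc n} (false ∷ x) x≢0 g 0≤g = begin
    𝔼 j (μ (suc n)) (λ S → g (parity S (false ∷ x)))
      ≡⟨ step n (λ S → g (parity S (false ∷ x))) ⟩
    seq p j ℚ.* B ℚ.+ (1ℚ ℚ.- seq p j) ℚ.* B
      ≡⟨ solve 2 (λ p B → p :* B :+ (con 1ℚ :- p) :* B := B) refl (seq p j) B ⟩
    B
      ≤⟨ go x x≢0 g 0≤g ⟩
    q ℚ.* (g true ℚ.+ g false) ∎
    where
    B = 𝔼 j (μ n) (λ S → g (parity S x))

-- Sums over all assignments

Σᵛ : ∀ n → (Assignment n → ℚ) → ℚ
Σᵛ zero    f = f []
Σᵛ (suc n) f = Σᵛ n (λ x → f (true ∷ x)) ℚ.+ Σᵛ n (λ x → f (false ∷ x))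

Σᵛ-mono : ∀ n {f g} → (∀ x → f x ℚ.≤ g x) → Σᵛ n f ℚ.≤ Σᵛ n g
Σᵛ-mono zero    f≤g = f≤g []
Σᵛ-mono (suc n) f≤g = ℚ.+-mono-≤ (Σᵛ-mono n (λ x → f≤g (true ∷ x))) (Σᵛ-mono n (λ x → f≤g (false ∷ x)))

Σᵛ-nonNeg : ∀ n {f} → (∀ x → 0ℚ ℚ.≤ f x) → 0ℚ ℚ.≤ Σᵛ n f
Σᵛ-nonNeg zero    0≤f = 0≤f []
Σᵛ-nonNeg (suc n) 0≤f = +-nonNeg (Σᵛ-nonNeg n (λ x → 0≤f (true ∷ x))) (Σᵛ-nonNeg n (λ x → 0≤f (false ∷ x)))

term≤Σᵛ : ∀ {n f} → (∀ x → 0ℚ ℚ.≤ f x) → ∀ x → f x ℚ.≤ Σᵛ n f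
term≤Σᵛ     0≤f []          = ℚ.≤-refl
term≤Σᵛ {suc n} {f} 0≤f (true ∷ x)  = ℚ.≤-trans (term≤Σᵛ (λ x → 0≤f (true ∷ x)) x)
  (p+d≡q⇒p≤q _ (Σᵛ-nonNeg n (λ x → 0≤f (false ∷ x))) refl)
term≤Σᵛ {suc n} {f} 0≤f (false ∷ x) = ℚ.≤-trans (term≤Σᵛ (λ x → 0≤f (false ∷ x)) x)
  (p+d≡q⇒p≤q _ (Σᵛ-nonNeg n (λ x → 0≤f (true ∷ x))) (ℚ.+-comm _ (Σᵛ n (λ x → f (true ∷ x)))))

Σᵛ-*ˡ : ∀ n c f → Σᵛ n (λ x → c ℚ.* f x) ≡ c ℚ.* Σᵛ n f
Σᵛ-*ˡ zero    c f = refl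
Σᵛ-*ˡ (suc n) c f = trans (cong₂ ℚ._+_ (Σᵛ-*ˡ n c (λ x → f (true ∷ x))) (Σᵛ-*ˡ n c (λ x → f (false ∷ x))))
  (sym (ℚ.*-distribˡ-+ c (Σᵛ n (λ x → f (true ∷ x))) (Σᵛ n (λ x → f (false ∷ x)))))

Σᵛ-*ʳ : ∀ n c f → Σᵛ n (λ x → f x ℚ.* c) ≡ Σᵛ n f ℚ.* c
Σᵛ-*ʳ zero    c f = refl
Σᵛ-*ʳ (suc n) c f = trans (cong₂ ℚ._+_ (Σᵛ-*ʳ n c (λ x → f (true ∷ x))) (Σᵛ-*ʳ n c (λ x → f (false ∷ x))))
  (sym (ℚ.*-distribʳ-+ c (Σᵛ n (λ x → f (true ∷ x))) (Σᵛ n (λ x → f (false ∷ x)))))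

𝔼-Σᵛ : ∀ {A} j (μ : Dist A) n (f : Assignment n → A → ℚ) →
  𝔼 j μ (λ a → Σᵛ n (λ x → f x a)) ≡ Σᵛ n (λ x → 𝔼 j μ (f x))
𝔼-Σᵛ j μ zero    f = refl
𝔼-Σᵛ j μ (suc n) f = trans (𝔼-+ j μ _ _)
  (cong₂ ℚ._+_ (𝔼-Σᵛ j μ n (λ x → f (true ∷ x))) (𝔼-Σᵛ j μ n (λ x → f (false ∷ x))))

-- Each coordinate contributes `u` if true and 1 if false, hence a factor 1 + u.
Σᵛ-binomial : ∀ n u → Σᵛ n (λ x → u ^ ∣ x ∣) ≡ (1ℚ ℚ.+ u) ^ n
Σᵛ-binomial zero    u = refl
Σᵛ-binomial (suc n) u = begin
  Σᵛ n (λ x → u ℚ.* u ^ ∣ x ∣) ℚ.+ s         ≡⟨ cong (ℚ._+ s) (Σᵛ-*ˡ n u _) ⟩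
  u ℚ.* s ℚ.+ s                             ≡⟨ solve 2 (λ u s → u :* s :+ s := (con 1ℚ :+ u) :* s) refl u s ⟩
  (1ℚ ℚ.+ u) ℚ.* s                          ≡⟨ cong ((1ℚ ℚ.+ u) ℚ.*_) (Σᵛ-binomial n u) ⟩
  (1ℚ ℚ.+ u) ℚ.* (1ℚ ℚ.+ u) ^ n             ∎
  where
  open ≡-Reasoning
  s = Σᵛ n (λ x → u ^ ∣ x ∣)

-- Random formulas

open IsProb

-- The constant is dropped: two solutions meet the same constant, so it cancels in their difference,
-- leaving only orthogonality to the variable set.
agree : ∀ {n} → Assignment n → XorClause n → ℚ
agree x (xorClause _ S) = 𝟙 (not (parity S x))

-- u ^ h, except that the zero vector of the kernel (h = 0) is discarded.
θ : ℚ → ℕ → ℚ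
θ u zero    = 0ℚ
θ u (suc h) = u ^ suc h

θ-nonNeg : ∀ {u} h → 0ℚ ℚ.≤ u → 0ℚ ℚ.≤ θ u h
θ-nonNeg zero    0≤u = ℚ.≤-refl
θ-nonNeg (suc h) 0≤u = ^-nonNeg (suc h) 0≤u

θ-≢0 : ∀ u {h} → h ≢ 0 → θ u h ≡ u ^ h
θ-≢0 u {zero}  h≢0 = contradiction refl h≢0
θ-≢0 u {suc h} _   = refl

-- The zero vector is orthogonal to every variable set, so `a ≤ q` can be asked only when `h` is
-- nonzero; at zero `θ` makes the left side vanish.
θ*^-≤ : ∀ {u a q} h l → 0ℚ ℚ.≤ u → 0ℚ ℚ.≤ a → 0ℚ ℚ.≤ q → (h ≢ 0 → a ℚ.≤ q) →
  θ u h ℚ.* a ^ l ℚ.≤ u ^ h ℚ.* q ^ l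
θ*^-≤ {u} {a} {q} zero l 0≤u 0≤a 0≤q _ =
  subst (ℚ._≤ 1ℚ ℚ.* q ^ l) (sym (ℚ.*-zeroˡ (a ^ l))) (*-nonNeg 0≤1 (^-nonNeg l 0≤q))
θ*^-≤ (suc h) l 0≤u 0≤a 0≤q a≤q =
  *-monoˡ-≤ (^-nonNeg (suc h) 0≤u) (^-monoˡ-≤ l 0≤a (a≤q (λ ())))

-- The weight enumerator, evaluated at `u`, of the nonzero kernel vectors of the homogeneous XOR
-- system.
kernelSum : ℚ → ∀ {n l} → Vec (XorClause n) l → ℚ
kernelSum u {n} Xs = Σᵛ n (λ x → θ u ∣ x ∣ ℚ.* ∏ (agree x) Xs)

module _ (j : ℕ) (p : ℝ) (0≤p : 0ℚ ℚ.≤ seq p j) (0≤1-p : 0ℚ ℚ.≤ 1ℚ ℚ.- seq p j) where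

  ½-isProb : IsProb j (bernoulli ½ℝ)
  ½-isProb = bernoulli-isProb j ½ℝ (ℚ.nonNegative⁻¹ ½) (ℚ.nonNegative⁻¹ ½)

  randomXorClause-isProb : ∀ n → IsProb j (randomXorClause p n)
  randomXorClause-isProb n =
    >>=-isProb j (iid-isProb j n (bernoulli-isProb j p 0≤p 0≤1-p)) (λ S →
      >>=-isProb j ½-isProb (λ b → return-isProb j (xorClause b S)))

  𝔼-agree : ∀ {n} (x : Assignment n) → 𝔼 j (randomXorClause p n) (agree x) ≡
    𝔼 j (iid n (bernoulli p)) (λ S → 𝟙 (not (parity S x)))
  𝔼-agree {n} x = trans (𝔼->>= j (iid n (bernoulli p)) _ (agree x))
    (𝔼-cong j (iid n (bernoulli p)) (λ S →
      trans (𝔼->>= j (bernoulli ½ℝ) (λ b → return (xorClause b S)) (agree x))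
        (trans (𝔼-cong j (bernoulli ½ℝ) (λ b → 𝔼-return j (xorClause b S) (agree x)))
          (const ½-isProb _))))

module _ (j : ℕ) (p : ℝ) {q : ℚ} (bias : BiasBound (seq p j) q) where

  open BiasBound bias

  𝔼-agree-≤ : ∀ {n} (x : Assignment n) → ∣ x ∣ ≢ 0 → 𝔼 j (randomXorClause p n) (agree x) ℚ.≤ q
  𝔼-agree-≤ {n} x x≢0 = begin
    𝔼 j (randomXorClause p n) (agree x)
      ≡⟨ 𝔼-agree j p 0≤x 0≤1-x x ⟩
    𝔼 j (iid n (bernoulli p)) (λ S → 𝟙 (not (parity S x)))
      ≤⟨ parity-bound j p bias x x≢0 (λ b → 𝟙 (not b)) (λ b → 0≤𝟙 (not b)) ⟩
    q ℚ.* (0ℚ ℚ.+ 1ℚ)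
      ≡⟨ ℚ.*-identityʳ q ⟩
    q ∎
    where
    open ℚ.≤-Reasoning

  -- First-moment computation: linearity over the vectors, independence over the clauses, then the
  -- binomial theorem.
  𝔼-kernelSum-≤ : ∀ {u} n l → 0ℚ ℚ.≤ u → 𝔼 j (iid l (randomXorClause p n)) (kernelSum u) ℚ.≤ (1ℚ ℚ.+ u) ^ n ℚ.* q ^ l
  𝔼-kernelSum-≤ {u} n l 0≤u = begin
    𝔼 j (iid l μ) (kernelSum u)
      ≡⟨ 𝔼-Σᵛ j (iid l μ) n (λ x Xs → θ u ∣ x ∣ ℚ.* ∏ (agree x) Xs) ⟩
    Σᵛ n (λ x → 𝔼 j (iid l μ) (λ Xs → θ u ∣ x ∣ ℚ.* ∏ (agree x) Xs))
      ≤⟨ Σᵛ-mono n term ⟩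
    Σᵛ n (λ x → u ^ ∣ x ∣ ℚ.* q ^ l)
      ≡⟨ Σᵛ-*ʳ n (q ^ l) (λ x → u ^ ∣ x ∣) ⟩
    Σᵛ n (λ x → u ^ ∣ x ∣) ℚ.* q ^ l
      ≡⟨ cong (ℚ._* q ^ l) (Σᵛ-binomial n u) ⟩
    (1ℚ ℚ.+ u) ^ n ℚ.* q ^ l ∎
    where
    open ℚ.≤-Reasoning
    μ = randomXorClause p n
    term : ∀ x → 𝔼 j (iid l μ) (λ Xs → θ u ∣ x ∣ ℚ.* ∏ (agree x) Xs) ℚ.≤ u ^ ∣ x ∣ ℚ.* q ^ l
    term x = begin
      𝔼 j (iid l μ) (λ Xs → θ u ∣ x ∣ ℚ.* ∏ (agree x) Xs)
        ≡⟨ 𝔼-*ˡ j (iid l μ) (θ u ∣ x ∣) (∏ (agree x)) ⟩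
      θ u ∣ x ∣ ℚ.* 𝔼 j (iid l μ) (∏ (agree x))
        ≡⟨ cong (θ u ∣ x ∣ ℚ.*_) (𝔼-∏ j l μ (agree x)) ⟩
      θ u ∣ x ∣ ℚ.* 𝔼 j μ (agree x) ^ l
        ≤⟨ θ*^-≤ ∣ x ∣ l 0≤u
             (nonNeg (randomXorClause-isProb j p 0≤x 0≤1-x n) (λ (xorClause _ S) → 0≤𝟙 (not (parity S x))))
             (ℚ.≤-trans 0≤x x≤q) (𝔼-agree-≤ x) ⟩
      u ^ ∣ x ∣ ℚ.* q ^ l ∎

-- Total mass of the random formula and the marginal of its XOR part

∈-vectors : ∀ {A : Set} {as : List A} → (∀ a → a ∈ as) → ∀ {n} (v : Vec A n) → v ∈ vectors as n
∈-vectors ∈as []      = here refl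
∈-vectors ∈as (a ∷ v) = ∈-cartesianProductWith⁺ _∷_ (∈as a) (∈-vectors ∈as v)

clauseOfSize : ∀ {k n} → k ℕ.≤ n → ∃[ C ] ∣ clauseVars {n} C ∣ ≡ k
clauseOfSize {n = zero}  ℕ.z≤n       = [] , refl
clauseOfSize {n = suc n} ℕ.z≤n       = let C , ∣C∣≡0 = clauseOfSize ℕ.z≤n in nothing ∷ C , ∣C∣≡0
clauseOfSize             (ℕ.s≤s k≤n) = let C , ∣C∣≡k = clauseOfSize k≤n in just true ∷ C , cong suc ∣C∣≡k

-- Keeps the uniform distribution on clauses from being the empty dummy; this is why the estimates
-- are made for n ≥ k.
kClauses-nonempty : ∀ {k n} → k ℕ.≤ n → ∃[ C ] C ∈ kClauses k n
kClauses-nonempty k≤n = let C , ∣C∣≡k = clauseOfSize k≤n in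
  C , ∈-filter⁺ (λ C → ∣ clauseVars C ∣ ℕ.≟ _) (∈-vectors complete C) ∣C∣≡k
  where
  complete : (a : Maybe Bool) → a ∈ (nothing ∷ just true ∷ just false ∷ [])
  complete nothing      = here refl
  complete (just true)  = there (here refl)
  complete (just false) = there (there (here refl))

module _ (j : ℕ) {k n : ℕ} (p : ℝ) (k≤n : k ℕ.≤ n)
  (0≤p : 0ℚ ℚ.≤ seq p j) (0≤1-p : 0ℚ ℚ.≤ 1ℚ ℚ.- seq p j) where

  private
    clauses-isProb : ∀ m → IsProb j (iid m (uniform (kClauses k n)))
    clauses-isProb m = iid-isProb j m (uniform-isProb j (kClauses k n) (proj₂ (kClauses-nonempty k≤n)))

    xors-isProb : ∀ l → IsProb j (iid l (randomXorClause p n))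
    xors-isProb l = iid-isProb j l (randomXorClause-isProb j p 0≤p 0≤1-p n)

  ψ-isProb : ∀ m l → IsProb j (ψ k p n m l)
  ψ-isProb m l = >>=-isProb j (clauses-isProb m) (λ Cs →
    >>=-isProb j (xors-isProb l) (λ Xs → return-isProb j (Cs , Xs)))

  Pr≤1 : ∀ m l {E : Pred (Formula n m l) _} (E? : Decidable E) → seq (Pr (ψ k p n m l) E?) j ℚ.≤ 1ℚ
  Pr≤1 m l E? = subst₂ ℚ._≤_ (sym (seq-Pr j (ψ k p n m l) E?)) (ψ-isProb m l .total)
    (ψ-isProb m l .mono (λ φ → 𝟙≤1 (does (E? φ))))
    where
    𝟙≤1 : ∀ b → 𝟙 b ℚ.≤ 1ℚ
    𝟙≤1 true  = ℚ.≤-refl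
    𝟙≤1 false = 0≤1

  -- The k-clauses integrate out because their distribution has total mass 1.
  𝔼-ψ-xors : ∀ m l f → 𝔼 j (ψ k p n m l) (λ φ → f (proj₂ φ)) ≡ 𝔼 j (iid l (randomXorClause p n)) f
  𝔼-ψ-xors m l f =
    trans (𝔼->>= j (iid m (uniform (kClauses k n))) _ (λ φ → f (proj₂ φ)))
      (trans (𝔼-cong j (iid m (uniform (kClauses k n))) (λ Cs →
          trans (𝔼->>= j (iid l (randomXorClause p n)) (λ Xs → return (Cs , Xs)) (λ φ → f (proj₂ φ)))
            (𝔼-cong j (iid l (randomXorClause p n)) (λ Xs → 𝔼-return j (Cs , Xs) (λ φ → f (proj₂ φ))))))
        (const (clauses-isProb m) _))

-- Deciding separation, and close solutions in the kernel

∀-assignment? : ∀ {n} {P : Assignment n → Set} → Decidable P → Dec (∀ σ → P σ)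
∀-assignment? {n} P? = map′ (λ all σ → List.lookup all (∈-vectors ∈bools σ)) (λ f → List.universal f _)
  (List.all? P? (vectors bools n))
  where
  bools = true ∷ false ∷ []
  ∈bools : ∀ b → b ∈ bools
  ∈bools true  = here refl
  ∈bools false = there (here refl)

_⊨?_ : ∀ {n m l} (σ : Assignment n) (φ : Formula n m l) → Dec (σ ⊨ φ)
σ ⊨? (Cs , Xs) =
  All.all? (λ C → Fin.any? (λ i → Maybe.≡-dec Bool._≟_ (lookup C i) (just (lookup σ i)))) Cs
  ×-dec All.all? (λ (xorClause b S) → (b xor parity S σ) Bool.≟ true) Xs

-- The order on reals is not decidable in general, so the comparison with the threshold is supplied;
-- everything else is a finite search.
separated? : ∀ {n m l d} → (∀ h → Dec (d ≤ fromℕ h)) → (φ : Formula n m l) → Dec ((d -Separated) φ)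
separated? d≤? φ = ∀-assignment? λ σ → ∀-assignment? λ τ →
  σ ⊨? φ →-dec τ ⊨? φ →-dec ¬? (Vec.≡-dec Bool._≟_ σ τ) →-dec d≤? (hamming σ τ)

agree-⊕ : ∀ {n} {σ τ : Assignment n} X → σ ⊨ˣ X → τ ⊨ˣ X → agree (σ ⊕ τ) X ≡ 1ℚ
agree-⊕ {σ = σ} {τ} (xorClause b S) σ⊨ τ⊨ =
  cong (λ c → 𝟙 (not c)) (trans (parity-⊕ S σ τ) (cancel b (parity S σ) (parity S τ) σ⊨ τ⊨))
  where
  cancel : ∀ b c d → b xor c ≡ true → b xor d ≡ true → c xor d ≡ false
  cancel false true  true  _ _ = refl
  cancel true  false false _ _ = refl

∏-agree-⊕ : ∀ {n l} {σ τ : Assignment n} {Xs : Vec (XorClause n) l} →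
  All (σ ⊨ˣ_) Xs → All (τ ⊨ˣ_) Xs → ∏ (agree (σ ⊕ τ)) Xs ≡ 1ℚ
∏-agree-⊕ []         []         = refl
∏-agree-⊕ {Xs = X ∷ _} (σ⊨ ∷ σ⊨s) (τ⊨ ∷ τ⊨s) = cong₂ ℚ._*_ (agree-⊕ X σ⊨ τ⊨) (∏-agree-⊕ σ⊨s τ⊨s)

-- Two solutions at distance h below the threshold put the term z^(Lh) ≥ zˡ into the sum. Such a
-- pair is never extracted: if the decidable conclusion failed, no close pair could exist and the
-- formula would be separated.
¬separated⇒z^l≤kernelSum : ∀ {z n m l L d} → 0ℚ ℚ.≤ z → z ℚ.≤ 1ℚ →
  (∀ h → Dec (d ≤ fromℕ h)) → (∀ h → ¬ d ≤ fromℕ h → L ℕ.* h ℕ.≤ l) →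
  (φ : Formula n m l) → ¬ (d -Separated) φ → z ^ l ℚ.≤ kernelSum (z ^ L) (proj₂ φ)
¬separated⇒z^l≤kernelSum {z} {n} {m} {l} {L} {d} 0≤z z≤1 d≤? close (Cs , Xs) ¬sep
  with z ^ l ℚ.≤? kernelSum (z ^ L) Xs
... | yes z^l≤ = z^l≤
... | no  z^l≰ = contradiction sep ¬sep
  where
  u = z ^ L
  sep : (d -Separated) (Cs , Xs)
  sep σ τ (_ , σ⊨) (_ , τ⊨) σ≢τ with d≤? (hamming σ τ)
  ... | yes d≤ = d≤
  ... | no  d≰ = contradiction (begin
    z ^ l                          ≤⟨ ^-antimonoʳ-≤ 0≤z z≤1 (close (hamming σ τ) d≰) ⟩
    z ^ (L ℕ.* hamming σ τ)        ≡⟨ ^-assocʳ z L (hamming σ τ) ⟨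
    u ^ hamming σ τ                ≡⟨ θ-≢0 u (λ h≡0 → σ≢τ (∣σ⊕τ∣≡0⇒σ≡τ σ τ h≡0)) ⟨
    θ u (hamming σ τ)              ≡⟨ ℚ.*-identityʳ _ ⟨
    θ u (hamming σ τ) ℚ.* 1ℚ       ≡⟨ cong (θ u (hamming σ τ) ℚ.*_) (∏-agree-⊕ σ⊨ τ⊨) ⟨
    θ u (hamming σ τ) ℚ.* ∏ (agree (σ ⊕ τ)) Xs
      ≤⟨ term≤Σᵛ (λ x → *-nonNeg (θ-nonNeg ∣ x ∣ (^-nonNeg L 0≤z))
                          (∏-nonNeg (λ (xorClause _ S) → 0≤𝟙 (not (parity S x))) Xs)) (σ ⊕ τ) ⟩
    kernelSum u Xs                 ∎) z^l≰
    where open ℚ.≤-Reasoning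

-- Separation with high probability

0<x⇒bounded-below : ∀ {x} → 0ℝ < x → ∃[ δ ] 0ℚ ℚ.< δ × ∃[ N ] (∀ j → N ℕ.≤ j → δ ℚ.≤ seq x j)
0<x⇒bounded-below {x} (δ , 0<δ , N , h) = δ , 0<δ , N , λ j N≤j →
  subst (ℚ._≤ seq x j) (ℚ.+-identityˡ δ) (h j N≤j)

fromℚ-cancel-≤ : ∀ {a b} → fromℚ a ≤ fromℚ b → a ℚ.≤ b
fromℚ-cancel-≤ a≤b = ≤-closed (λ ε 0<ε → let N , h = a≤b ε 0<ε in h N ℕ.≤-refl)

fromℚ-mono-≤ : ∀ {a b} → a ℚ.≤ b → fromℚ a ≤ fromℚ b
fromℚ-mono-≤ {b = b} a≤b ε 0<ε = 0 , λ _ _ → ℚ.≤-trans a≤b (p+d≡q⇒p≤q ε (ℚ.<⇒≤ 0<ε) refl)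

-- If δ > 0 eventually bounds the approximations of `s` from below and δ(M + 1) ≥ 1, then n ≤ (M +
-- 1)δn ≤ (M + 1)⌈sn⌉.
ceiling-linear : ∀ {s} {⌈sn⌉ : ℕ → ℕ} → 0ℝ < s → (∀ n → s * fromℕ n ≤ fromℕ (⌈sn⌉ n)) →
  ∃[ M ] (∀ n → n ℕ.≤ suc M ℕ.* ⌈sn⌉ n)
ceiling-linear {s} {⌈sn⌉} 0<s sn≤ with 0<x⇒bounded-below {s} 0<s
... | δ , 0<δ , N , δ≤s with archimedean 0<δ
... | M , 1≤δM = M , λ n → ι-cancel-≤ (begin
  ι n                             ≡⟨ ℚ.*-identityˡ (ι n) ⟨
  1ℚ ℚ.* ι n                      ≤⟨ *-monoʳ-≤ (0≤ι n) 1≤δM ⟩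
  δ ℚ.* ι (suc M) ℚ.* ι n
    ≡⟨ solve 3 (λ δ m n → δ :* m :* n := m :* (δ :* n)) refl δ (ι (suc M)) (ι n) ⟩
  ι (suc M) ℚ.* (δ ℚ.* ι n)       ≤⟨ *-monoˡ-≤ (0≤ι (suc M)) (≤-closed (δn≤ n)) ⟩
  ι (suc M) ℚ.* ι (⌈sn⌉ n)        ≡⟨ ι-* (suc M) (⌈sn⌉ n) ⟨
  ι (suc M ℕ.* ⌈sn⌉ n)            ∎)
  where
  open ℚ.≤-Reasoning
  δn≤ : ∀ n ε → 0ℚ ℚ.< ε → δ ℚ.* ι n ℚ.≤ ι (⌈sn⌉ n) ℚ.+ ε
  δn≤ n ε 0<ε = let K , h = sn≤ n ε 0<ε in
    ℚ.≤-trans (*-monoʳ-≤ (0≤ι n) (δ≤s (N ℕ.⊔ K) (ℕ.m≤m⊔n N K))) (h (N ℕ.⊔ K) (ℕ.m≤n⊔m N K))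

-- A rational slope makes comparison with a Hamming distance decidable, which a real slope need not.
gap : ℕ → ℕ → ℝ
gap κ n = fromℚ (+ 1 / suc κ) * fromℕ n

gap-Ω : ∀ κ → IsΩ[n] (gap κ)
gap-Ω κ = fromℚ c , (c , ℚ.positive⁻¹ c {{ℚ.normalize-pos 1 (suc κ)}} , 0 , λ _ _ → ℚ.≤-reflexive (ℚ.+-identityˡ c))
  , 0 , λ n _ → fromℚ-mono-≤ (ℚ.≤-refl {c ℚ.* ι n})
  where
  c = + 1 / suc κ

gap≤? : ∀ κ n h → Dec (gap κ n ≤ fromℕ h)
gap≤? κ n h = map′ fromℚ-mono-≤ fromℚ-cancel-≤ ((+ 1 / suc κ) ℚ.* ι n ℚ.≤? ι h)

n≤[1+κ]h⇒gap≤h : ∀ κ n h → n ℕ.≤ suc κ ℕ.* h → gap κ n ≤ fromℕ h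
n≤[1+κ]h⇒gap≤h κ n h n≤ = fromℚ-mono-≤ (begin
  c ℚ.* ι n                    ≤⟨ *-monoˡ-≤ (ℚ.nonNegative⁻¹ c {{ℚ.normalize-nonNeg 1 (suc κ)}}) (ι-mono-≤ n≤) ⟩
  c ℚ.* ι (suc κ ℕ.* h)        ≡⟨ cong (c ℚ.*_) (ι-* (suc κ) h) ⟩
  c ℚ.* (ι (suc κ) ℚ.* ι h)
    ≡⟨ solve 3 (λ c k h → c :* (k :* h) := k :* c :* h) refl c (ι (suc κ)) (ι h) ⟩
  ι (suc κ) ℚ.* c ℚ.* ι h      ≡⟨ cong (ℚ._* ι h) (ι*1/n≡1 κ) ⟩
  1ℚ ℚ.* ι h                   ≡⟨ ℚ.*-identityˡ (ι h) ⟩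
  ι h                          ∎)
  where
  open ℚ.≤-Reasoning
  c = + 1 / suc κ

-- `suc (L + M * suc L)` is definitionally `suc M * suc L`, so the threshold is n / ((M + 1)(L +
-- 1)). If l were below (L + 1)h, then n ≤ (M + 1)l would put h above this threshold.
gap≰h⇒Lh≤l : ∀ M L n h l → n ℕ.≤ suc M ℕ.* l → ¬ gap (L ℕ.+ M ℕ.* suc L) n ≤ fromℕ h → suc L ℕ.* h ℕ.≤ l
gap≰h⇒Lh≤l M L n h l n≤Ml gap≰h with suc L ℕ.* h ℕ.≤? l
... | yes Lh≤l = Lh≤l
... | no  Lh≰l = contradiction (n≤[1+κ]h⇒gap≤h (L ℕ.+ M ℕ.* suc L) n h (begin
  n                          ≤⟨ n≤Ml ⟩
  suc M ℕ.* l                ≤⟨ ℕ.*-monoʳ-≤ (suc M) (ℕ.<⇒≤ (ℕ.≰⇒> Lh≰l)) ⟩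
  suc M ℕ.* (suc L ℕ.* h)    ≡⟨ ℕ.*-assoc (suc M) (suc L) h ⟨
  suc M ℕ.* suc L ℕ.* h      ∎)) gap≰h
  where open ℕ.≤-Reasoning

-- Bounding the failure probability at a fixed n

module _ (j : ℕ) {k n m l M L : ℕ} (p : ℝ) {q z : ℚ} {d : ℝ} (k≤n : k ℕ.≤ n)
  (bias : BiasBound (seq p j) q) (0<z : 0ℚ ℚ.< z) (z≤1 : z ℚ.≤ 1ℚ)
  (z²-bound : (1ℚ ℚ.+ z ^ L) ^ M ℚ.* q ℚ.≤ z ℚ.* z) (n≤Ml : n ℕ.≤ M ℕ.* l)
  (d≤? : ∀ h → Dec (d ≤ fromℕ h)) (close : ∀ h → ¬ d ≤ fromℕ h → L ℕ.* h ℕ.≤ l) where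

  open BiasBound bias

  private
    u = z ^ L
    0≤u : 0ℚ ℚ.≤ u
    0≤u = ^-nonNeg L (ℚ.<⇒≤ 0<z)
    0≤1+u : 0ℚ ℚ.≤ 1ℚ ℚ.+ u
    0≤1+u = +-nonNeg 0≤1 0≤u
    0≤q = ℚ.≤-trans 0≤x x≤q
    pψ = ψ-isProb j p k≤n 0≤x 0≤1-x m l

  -- Of the two factors zˡ, one is spent in Markov's inequality, whose level is zˡ; the other
  -- remains as the bound on failure.
  union-bound : (1ℚ ℚ.+ u) ^ n ℚ.* q ^ l ℚ.≤ z ^ l ℚ.* z ^ l
  union-bound = begin
    (1ℚ ℚ.+ u) ^ n ℚ.* q ^ l
      ≤⟨ *-monoʳ-≤ (^-nonNeg l 0≤q) (^-monoʳ-≤ (p+d≡q⇒p≤q u 0≤u refl) n≤Ml) ⟩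
    (1ℚ ℚ.+ u) ^ (M ℕ.* l) ℚ.* q ^ l
      ≡⟨ cong (ℚ._* q ^ l) (^-assocʳ (1ℚ ℚ.+ u) M l) ⟨
    ((1ℚ ℚ.+ u) ^ M) ^ l ℚ.* q ^ l
      ≡⟨ ^-distrib-* ((1ℚ ℚ.+ u) ^ M) q l ⟨
    ((1ℚ ℚ.+ u) ^ M ℚ.* q) ^ l
      ≤⟨ ^-monoˡ-≤ l (*-nonNeg (^-nonNeg M 0≤1+u) 0≤q) z²-bound ⟩
    (z ℚ.* z) ^ l
      ≡⟨ ^-distrib-* z z l ⟩
    z ^ l ℚ.* z ^ l ∎
    where open ℚ.≤-Reasoning

  -- Markov's inequality for the kernel sum, with failure written as one minus success so that no
  -- complementary event appears.
  1≤z^l+Pr : (E? : Decidable {A = Formula n m l} (d -Separated)) →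
    1ℚ ℚ.≤ z ^ l ℚ.+ seq (Pr (ψ k p n m l) E?) j
  1≤z^l+Pr E? = ℚ.*-cancelˡ-≤-pos (z ^ l) {{ℚ.positive (^-pos l 0<z)}} (begin
    z ^ l ℚ.* 1ℚ
      ≡⟨ ℚ.*-identityʳ (z ^ l) ⟩
    z ^ l
      ≡⟨ const pψ (z ^ l) ⟨
    𝔼 j (ψ k p n m l) (λ _ → z ^ l)
      ≤⟨ pψ .mono pointwise ⟩
    𝔼 j (ψ k p n m l) (λ φ → kernelSum u (proj₂ φ) ℚ.+ z ^ l ℚ.* 𝟙 (does (E? φ)))
      ≡⟨ 𝔼-+ j (ψ k p n m l) (λ φ → kernelSum u (proj₂ φ)) (λ φ → z ^ l ℚ.* 𝟙 (does (E? φ))) ⟩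
    𝔼 j (ψ k p n m l) (λ φ → kernelSum u (proj₂ φ)) ℚ.+ 𝔼 j (ψ k p n m l) (λ φ → z ^ l ℚ.* 𝟙 (does (E? φ)))
      ≡⟨ cong₂ ℚ._+_ (𝔼-ψ-xors j p k≤n 0≤x 0≤1-x m l (kernelSum u))
           (trans (𝔼-*ˡ j (ψ k p n m l) (z ^ l) (λ φ → 𝟙 (does (E? φ))))
             (cong (z ^ l ℚ.*_) (sym (seq-Pr j (ψ k p n m l) E?)))) ⟩
    𝔼 j (iid l (randomXorClause p n)) (kernelSum u) ℚ.+ z ^ l ℚ.* P
      ≤⟨ ℚ.+-monoˡ-≤ (z ^ l ℚ.* P)
           (ℚ.≤-trans (𝔼-kernelSum-≤ j p bias n l 0≤u) union-bound) ⟩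
    z ^ l ℚ.* z ^ l ℚ.+ z ^ l ℚ.* P
      ≡⟨ ℚ.*-distribˡ-+ (z ^ l) (z ^ l) P ⟨
    z ^ l ℚ.* (z ^ l ℚ.+ P) ∎)
    where
    open ℚ.≤-Reasoning
    P = seq (Pr (ψ k p n m l) E?) j
    kernelSum-nonNeg : ∀ (Xs : Vec (XorClause n) l) → 0ℚ ℚ.≤ kernelSum u Xs
    kernelSum-nonNeg Xs = Σᵛ-nonNeg n (λ x → *-nonNeg (θ-nonNeg ∣ x ∣ 0≤u)
      (∏-nonNeg (λ (xorClause _ S) → 0≤𝟙 (not (parity S x))) Xs))
    pointwise : ∀ φ → z ^ l ℚ.≤ kernelSum u (proj₂ φ) ℚ.+ z ^ l ℚ.* 𝟙 (does (E? φ))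
    pointwise φ with E? φ
    ... | yes _   = p+d≡q⇒p≤q (kernelSum u (proj₂ φ)) (kernelSum-nonNeg (proj₂ φ))
      (solve 2 (λ x s → x :+ s := s :+ x :* con 1ℚ) refl (z ^ l) (kernelSum u (proj₂ φ)))
    ... | no ¬sep = ℚ.≤-trans
      (¬separated⇒z^l≤kernelSum {L = L} {d = d} (ℚ.<⇒≤ 0<z) z≤1 d≤? close φ ¬sep)
      (p+d≡q⇒p≤q 0ℚ ℚ.≤-refl
        (solve 2 (λ x s → s :+ con 0ℚ := s :+ x :* con 0ℚ) refl (z ^ l) (kernelSum u (proj₂ φ))))


geometric⇒⟶1 : ∀ {z η} (f : ℕ → ℝ) (l : ℕ → ℕ) k M j₀ → 0ℚ ℚ.< z → 0ℚ ℚ.< η → z ≡ 1ℚ ℚ.- η →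
  (∀ n → n ℕ.≤ suc M ℕ.* l n) →
  (∀ n → k ℕ.≤ n → ∀ j → j₀ ℕ.≤ j → seq (f n) j ℚ.≤ 1ℚ) →
  (∀ n → k ℕ.≤ n → ∀ j → j₀ ℕ.≤ j → 1ℚ ℚ.≤ z ^ l n ℚ.+ seq (f n) j) →
  f ⟶ 1ℝ
geometric⇒⟶1 {z} {η} f l k M j₀ 0<z 0<η z≡1-η n≤Ml f≤1 1≤z^l+f ε 0<ε =
  let ε₀ , 0<ε₀ , j₁ , ε₀≤ε = 0<x⇒bounded-below {ε} 0<ε
      0<½ε₀ = *-pos (ℚ.positive⁻¹ ½) 0<ε₀
      l₀ , z^l₀≤½ε₀ = powers-vanish (ℚ.<⇒≤ 0<z) 0<η z≡1-η 0<½ε₀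
  in k ℕ.⊔ suc M ℕ.* suc l₀ , λ n N≤n →
  let k≤n   = ℕ.m⊔n≤o⇒m≤o k (suc M ℕ.* suc l₀) N≤n
      l₀≤ln = ℕ.*-cancelˡ-≤ (suc M) (ℕ.≤-trans (ℕ.m⊔n≤o⇒n≤o k (suc M ℕ.* suc l₀) N≤n) (n≤Ml n))
      z^l≤½ε₀ = ℚ.≤-trans (^-antimonoʳ-≤ (ℚ.<⇒≤ 0<z) z≤1 l₀≤ln) z^l₀≤½ε₀
  in (½ ℚ.* ε₀ , 0<½ε₀ , j₀ ℕ.⊔ j₁ , λ j j≥ →
        lower ε₀ (z ^ l n) (seq ε j) (seq (f n) j) z^l≤½ε₀
          (1≤z^l+f n k≤n j (ℕ.m⊔n≤o⇒m≤o j₀ j₁ j≥)) (ε₀≤ε j (ℕ.m⊔n≤o⇒n≤o j₀ j₁ j≥)))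
   , (ε₀ , 0<ε₀ , j₀ ℕ.⊔ j₁ , λ j j≥ →
        ℚ.+-mono-≤ (f≤1 n k≤n j (ℕ.m⊔n≤o⇒m≤o j₀ j₁ j≥)) (ε₀≤ε j (ℕ.m⊔n≤o⇒n≤o j₀ j₁ j≥)))
  where
  open ℚ.≤-Reasoning
  z≤1 : z ℚ.≤ 1ℚ
  z≤1 = p+d≡q⇒p≤q η (ℚ.<⇒≤ 0<η)
    (trans (cong (ℚ._+ η) z≡1-η) (solve 1 (λ η → con 1ℚ :- η :+ η := con 1ℚ) refl η))
  lower : ∀ e w d y → w ℚ.≤ ½ ℚ.* e → 1ℚ ℚ.≤ w ℚ.+ y → e ℚ.≤ d →
    1ℚ ℚ.- d ℚ.+ ½ ℚ.* e ℚ.≤ y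
  lower e w d y w≤½e 1≤w+y e≤d = begin
    1ℚ ℚ.- d ℚ.+ ½ ℚ.* e
      ≤⟨ ℚ.+-monoˡ-≤ (½ ℚ.* e) (ℚ.+-monoʳ-≤ 1ℚ (ℚ.neg-antimono-≤ e≤d)) ⟩
    1ℚ ℚ.- e ℚ.+ ½ ℚ.* e
      ≡⟨ cong (λ x → 1ℚ ℚ.- x ℚ.+ ½ ℚ.* e) (½p+½p≡p e) ⟨
    1ℚ ℚ.- (½ ℚ.* e ℚ.+ ½ ℚ.* e) ℚ.+ ½ ℚ.* e
      ≡⟨ solve 1 (λ x → con 1ℚ :- (x :+ x) :+ x := con 1ℚ :- x) refl (½ ℚ.* e) ⟩
    1ℚ ℚ.- ½ ℚ.* e
      ≤⟨ ℚ.+-mono-≤ 1≤w+y (ℚ.neg-antimono-≤ w≤½e) ⟩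
    w ℚ.+ y ℚ.- w
      ≡⟨ solve 2 (λ w y → w :+ y :- w := y) refl w y ⟩
    y ∎

¼ : ℚ
¼ = + 1 / 4

∃-quarter : ∀ {δ} → 0ℚ ℚ.< δ → ∃[ η ] 0ℚ ℚ.< η × η ℚ.+ η ℚ.+ (η ℚ.+ η) ℚ.≤ δ × η ℚ.+ η ℚ.+ (η ℚ.+ η) ℚ.≤ ¼
∃-quarter {δ} 0<δ =
    ½ ℚ.* (½ ℚ.* e)
  , *-pos 0<½ (*-pos 0<½ 0<e)
  , subst (ℚ._≤ δ) (sym 4η≡e) (ℚ.p⊓q≤p δ ¼)
  , subst (ℚ._≤ ¼) (sym 4η≡e) (ℚ.p⊓q≤q δ ¼)
  where
  e = δ ℚ.⊓ ¼
  0<½ = ℚ.positive⁻¹ ½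
  0<e : 0ℚ ℚ.< e
  0<e = [ (λ e≡δ → subst (0ℚ ℚ.<_) (sym e≡δ) 0<δ) , (λ e≡¼ → subst (0ℚ ℚ.<_) (sym e≡¼) (ℚ.positive⁻¹ ¼)) ]′
    (ℚ.⊓-sel δ ¼)
  4η≡e = trans (cong₂ ℚ._+_ (½p+½p≡p (½ ℚ.* e)) (½p+½p≡p (½ ℚ.* e))) (½p+½p≡p e)

-- The approximations of p ≤ 1/2 may exceed 1/2, but are eventually at most 3/4.
biasBound : ∀ {x η} → let 4η = η ℚ.+ η ℚ.+ (η ℚ.+ η) in
  0ℚ ℚ.< 4η → 4η ℚ.≤ x → 4η ℚ.≤ ¼ → x ℚ.≤ ½ ℚ.+ ¼ → BiasBound x (1ℚ ℚ.- 4η)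
biasBound 0<4η 4η≤x 4η≤¼ x≤¾ = record
  { 0≤x   = ℚ.≤-trans (ℚ.<⇒≤ 0<4η) 4η≤x
  ; 0≤1-x = p≤q⇒0≤q-p (ℚ.≤-trans x≤¾ (toWitness {a? = ½ ℚ.+ ¼ ℚ.≤? 1ℚ} _))
  ; x≤q   = ℚ.≤-trans x≤¾ (ℚ.+-monoʳ-≤ 1ℚ (ℚ.neg-antimono-≤ 4η≤¼))
  ; 1-x≤q = ℚ.+-monoʳ-≤ 1ℚ (ℚ.neg-antimono-≤ 4η≤x)
  }

linearly-separated : ∀ {k p} {⌈rn⌉ ⌈sn⌉ : ℕ → ℕ} {M j₀ η} → let 4η = η ℚ.+ η ℚ.+ (η ℚ.+ η) in
  0ℚ ℚ.< η → 4η ℚ.≤ ¼ → (∀ n → n ℕ.≤ suc M ℕ.* ⌈sn⌉ n) →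
  (∀ j → j₀ ℕ.≤ j → BiasBound (seq p j) (1ℚ ℚ.- 4η)) →
  ∃[ g ] IsΩ[n] g × WithHighProbability (λ n → ψ k p n (⌈rn⌉ n) (⌈sn⌉ n)) (λ n → g n -Separated)
linearly-separated {k} {p} {⌈rn⌉} {⌈sn⌉} {M} {j₀} {η} 0<η 4η≤¼ n≤Ml bias =
  let L , z²-bound = ∃-chernoff-exponent {z} (suc M) (ℚ.<⇒≤ 0<z) 0<η refl 0≤q
      κ = L ℕ.+ M ℕ.* suc L
      E? = λ n → separated? {d = gap κ n} (gap≤? κ n)
  in gap κ , gap-Ω κ , E?
   , geometric⇒⟶1 (λ n → Pr (ψ k p n (⌈rn⌉ n) (⌈sn⌉ n)) (E? n)) ⌈sn⌉ k M j₀
       0<z 0<η refl n≤Ml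
       (λ n k≤n j j≥ → Pr≤1 j p k≤n (BiasBound.0≤x (bias j j≥)) (BiasBound.0≤1-x (bias j j≥))
          (⌈rn⌉ n) (⌈sn⌉ n) (E? n))
       (λ n k≤n j j≥ → 1≤z^l+Pr j {M = suc M} {L = suc L} p {d = gap κ n} k≤n (bias j j≥) 0<z z≤1 z²-bound (n≤Ml n)
          (gap≤? κ n) (λ h → gap≰h⇒Lh≤l M L n h (⌈sn⌉ n) (n≤Ml n)) (E? n))
  where
  z = 1ℚ ℚ.- η
  0≤η = ℚ.<⇒≤ 0<η
  q = 1ℚ ℚ.- (η ℚ.+ η ℚ.+ (η ℚ.+ η))
  0<q : 0ℚ ℚ.< q
  0<q = ℚ.<-≤-trans (ℚ.positive⁻¹ (1ℚ ℚ.- ¼)) (ℚ.+-monoʳ-≤ 1ℚ (ℚ.neg-antimono-≤ 4η≤¼))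
  0≤q = ℚ.<⇒≤ 0<q
  0<z : 0ℚ ℚ.< z
  0<z = ℚ.<-≤-trans 0<q (p+d≡q⇒p≤q (η ℚ.+ (η ℚ.+ η)) (+-nonNeg 0≤η (+-nonNeg 0≤η 0≤η))
    (solve 1 (λ η → con 1ℚ :- (η :+ η :+ (η :+ η)) :+ (η :+ (η :+ η)) := con 1ℚ :- η) refl η))
  z≤1 : z ℚ.≤ 1ℚ
  z≤1 = p+d≡q⇒p≤q η 0≤η (solve 1 (λ η → con 1ℚ :- η :+ η := con 1ℚ) refl η)

mainTheorem3 : (k : ℕ) → .{{_ : NonZero k}} → (r s p : ℝ) → 0ℝ ≤ r → 0ℝ < s → s < 1ℝ → 0ℝ < p → p ≤ ½ℝ →
    (⌈rn⌉ ⌈sn⌉ : ℕ → ℕ) →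
    (∀ n → ⌈rn⌉ n IsCeilingOf r * fromℕ n) →
    (∀ n → ⌈sn⌉ n IsCeilingOf s * fromℕ n) →
    ∃[ g ] IsΩ[n] g × WithHighProbability (λ n → ψ k p n (⌈rn⌉ n) (⌈sn⌉ n)) (λ n → g n -Separated)
mainTheorem3 k r s p _ 0<s _ 0<p p≤½ ⌈rn⌉ ⌈sn⌉ _ ceil =
  let δ , 0<δ , j₁ , δ≤p = 0<x⇒bounded-below {p} 0<p
      j₂ , p≤¾           = p≤½ ¼ (ℚ.positive⁻¹ ¼)
      M , n≤Ml           = ceiling-linear {s} {⌈sn⌉} 0<s (λ n → proj₁ (ceil n))
      η , 0<η , 4η≤δ , 4η≤¼ = ∃-quarter 0<δ
  in linearly-separated {k} {p} {⌈rn⌉} {⌈sn⌉} {M} {j₁ ℕ.⊔ j₂} {η} 0<η 4η≤¼ n≤Ml (λ j j≥ →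
       biasBound {η = η} (ℚ.+-mono-< (ℚ.+-mono-< 0<η 0<η) (ℚ.+-mono-< 0<η 0<η))
         (ℚ.≤-trans 4η≤δ (δ≤p j (ℕ.m⊔n≤o⇒m≤o j₁ j₂ j≥))) 4η≤¼ (p≤¾ j (ℕ.m⊔n≤o⇒n≤o j₁ j₂ j≥)))
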